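{- Let $y$ be an integer such that $p=4y^2+5y+2$ is a prime with $p\ge 5$. Let $\beta\in\{ -8y-6,\ 8y+4\}$, $\mu=2p-2$, $\lambda=\mu+\beta$ and $k=4p^2-2p+\tfrac{\beta}{2}$. Then no nontrivial regular $(8p^3,k,\lambda,\mu)$-PDS exists in an Abelian group of order $8p^3$.
   Context: Let $G$ be a finite Abelian group of order $v$ with identity $e$, and $D\subseteq G$ a subset of size $k$. $D$ is a $(v,k,\lambda,\mu)$-partial difference set (PDS) in $G$ if the expressions $gh^{ -1}$ with $g,h\in D$, $g\neq h$, represent each non-identity element of $D$ exactly $\lambda$ times and each non-identity element of $G$ not in $D$ exactly $\mu$ times. $D$ is regular if moreover $D^{(-1)}=D$ and $e\notin D$. A regular PDS $D$ is trivial if $D\cup\{e\}$ or $G\setminus D$ is a subgroup of $G$. The parameter $\beta$ of a PDS is $\lambda-\mu$. -}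

module Defs where

open import Data.Nat using (ℕ)
open import Data.Fin using (Fin; _≟_)
open import Data.Fin.Subset using (Subset; _∈_; _∉_; ∣_∣; ⁅_⁆; _∪_; ∁)
open import Data.Fin.Subset.Properties using (_∈?_)
open import Data.List using (List; length; filter; cartesianProduct; allFin)
open import Data.Product using (_×_; _,_; proj₁; proj₂)
open import Data.Sum using (_⊎_)
open import Relation.Nullary using (¬_; Dec; yes; no)
open import Relation.Nullary.Decidable using (_×-dec_; ¬?)
open import Relation.Binary.PropositionalEquality using (_≡_; _≢_)
open import Algebra.Core using (Op₁; Op₂)

-- A finite (Abelian) group of order v is represented with carrier Fin v,
-- equality _≡_, and operations _∙_, ε, _⁻¹ (laws supplied separately as
-- IsAbelianGroup _≡_ _∙_ ε _⁻¹ in the statement).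
module PDSDefs {v : ℕ} (_∙_ : Op₂ (Fin v)) (ε : Fin v) (_⁻¹ : Op₁ (Fin v)) where

  rep : Subset v → Fin v → ℕ
  rep D x = length (filter P? (cartesianProduct (allFin v) (allFin v)))
    where
    P? : (q : Fin v × Fin v) → Dec ((proj₁ q ∈ D × proj₂ q ∈ D) × (proj₁ q ≢ proj₂ q × (proj₁ q ∙ (proj₂ q ⁻¹)) ≡ x))
    P? (g , h) = ((g ∈? D) ×-dec (h ∈? D)) ×-dec (¬? (g ≟ h) ×-dec ((g ∙ (h ⁻¹)) ≟ x))

  IsPDS : Subset v → ℕ → ℕ → ℕ → Set
  IsPDS D k lam μ =
    ∣ D ∣ ≡ k ×
    ((x : Fin v) → x ≢ ε → (x ∈ D → rep D x ≡ lam) × (x ∉ D → rep D x ≡ μ))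

  IsRegular : Subset v → Set
  IsRegular D = ((x : Fin v) → x ∈ D → (x ⁻¹) ∈ D) × ((x : Fin v) → (x ⁻¹) ∈ D → x ∈ D) × ε ∉ D

  IsSubgroup : Subset v → Set
  IsSubgroup S = ε ∈ S × ((x y : Fin v) → x ∈ S → y ∈ S → (x ∙ y) ∈ S) × ((x : Fin v) → x ∈ S → (x ⁻¹) ∈ S)

  IsTrivial : Subset v → Set
  IsTrivial D = IsSubgroup (D ∪ ⁅ ε ⁆) ⊎ IsSubgroup (∁ D)

{-# OPTIONS --safe #-}
-- Put t = 4p² − k and E = D + t e in ℤ[G]. Then E² = 4p E + μ G, so E ^ q ∈ (4p)^(q-1) E + ℤ G, while
-- E ^ q ≡ E^(q) modulo a prime q. Hence D is stable under g ↦ g ^ q for every prime q ∤ 2p, and thus under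
-- all powers coprime to 2p. Let N be the Sylow 2-subgroup. The (p − 1)-st roots of unity modulo p³, extended
-- by 1 modulo 8, act freely on G ∖ N, so |D ∩ N| ≡ k modulo p − 1 = (4y + 1)(y + 1). Since |D ∩ N| ≤ 7
-- this leaves only p = 11, λ = 6, |D ∩ N| = 5. There the same action on the representations of an
-- x ∈ D ∩ N as a quotient of elements of D shows that at least 6 of them are by elements of N,
-- but there are at most |D ∩ N| = 5 of these.
module Submission where

open import Defs
open import Data.Nat using (ℕ; _≤_; _^_; _∸_)
open import Data.Nat.Primality using (Prime)
open import Data.Integer using (ℤ; +_; -_)
open import Data.Fin using (Fin)
open import Data.Fin.Subset using (Subset)
open import Data.Product using (_×_)
open import Data.Sum using (_⊎_)
open import Relation.Nullary using (¬_)
open import Relation.Binary.PropositionalEquality using (_≡_)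
open import Algebra.Core using (Op₁; Op₂)
open import Algebra.Structures using (IsAbelianGroup)
import Data.Nat as N
import Data.Integer as Z

open import Algebra.Bundles using (CommutativeSemiring; AbelianGroup)
import Algebra.Properties.CommutativeMonoid.Mult as CommutativeMult
import Algebra.Properties.CommutativeMonoid.Sum as CommutativeSum
import Algebra.Properties.CommutativeSemiring.Binomial as Binomial
import Algebra.Properties.Group as GroupProperties
import Algebra.Properties.Monoid.Mult as MonoidMult
import Algebra.Properties.Semiring.Exp as Exp
import Algebra.Properties.Semiring.Mult as Mult
import Algebra.Properties.Semiring.Sum as Sum
open import Algebra.Structures.Biased using (IsCommutativeSemiringˡ)
open import Data.Empty using (⊥; ⊥-elim)
open import Data.Fin using (toℕ; fromℕ; fromℕ<; inject₁; _≟_)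
open import Data.Fin.Permutation using (Permutation; permutation)
open import Data.Fin.Properties using (toℕ-fromℕ; toℕ-fromℕ<; toℕ-inject₁; toℕ-injective; toℕ<n)
open import Data.Fin.Subset using (_∈_; _∉_; ∣_∣; inside; outside)
open import Data.Fin.Subset.Properties using (_∈?_; drop-there)
import Data.Integer.Properties as ℤ
import Data.Integer.Tactic.RingSolver as ℤSolver
open import Data.List using (List; []; _∷_; length; filter; map; tabulate; allFin; cartesianProduct)
import Data.List.Membership.DecPropositional as DecMembership
open import Data.List.Membership.Propositional using () renaming (_∈_ to _∈ₗ_)
open import Data.List.Membership.Propositional.Properties using (∈-filter⁺; ∈-filter⁻; ∈-map⁺; ∈-map⁻; ∈-allFin; ∈-cartesianProduct⁺)
open import Data.List.Membership.Propositional.Properties.WithK using (unique∧set⇒bag)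
open import Data.List.Properties using (length-map; length-tabulate; filter-notAll)
open import Data.List.Relation.Binary.BagAndSetEquality using (∼bag⇒↭)
open import Data.List.Relation.Binary.Permutation.Propositional.Properties using (↭-length)
open import Data.List.Relation.Unary.All using (All; []; _∷_)
open import Data.List.Relation.Unary.Any using () renaming (here to hereₗ)
open import Data.List.Relation.Unary.Unique.Propositional using (Unique)
open import Data.List.Relation.Unary.Unique.Propositional.Properties using () renaming (filter⁺ to filter-unique; map⁺ to map-unique; allFin⁺ to allFin-unique; cartesianProduct⁺ to cartesianProduct-unique)
open import Data.Nat using (zero; suc; _+_; _*_; _<_; z≤n; s≤s; z<s; s<s; _!; NonZero)
open import Data.Nat.Combinatorics using (_C_; nCn≡1; nCk≡n!/k![n-k]!; k![n∸k]!∣n!)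
import Data.Nat.Coprimality as Coprimality
open import Data.Nat.Coprimality using (Coprime; coprime⇒gcd≡1; coprime-divisor)
open import Data.Nat.DivMod using (_%_; _/_; m/n*n≡m; m≡m%n+[m/n]*n; m%n<n)
open import Data.Nat.Divisibility
open import Data.Nat.GCD using (gcd; gcd-GCD; module Bézout)
open import Data.Nat.ListAction using (product)
open import Data.Nat.Primality using (euclidsLemma; prime⇒irreducible; prime?; prime[2]; prime⇒nonTrivial; prime⇒nonZero)
open import Data.Nat.Primality.Factorisation using (factorise; module PrimeFactorisation)
import Data.Nat.Properties as ℕ
open import Data.Nat.Properties using (<-trans; <⇒≤; n<1+n; n∸n≡0; ∸-monoʳ-<; _!*_!≢0)
open import Data.Nat.Tactic.RingSolver using (solve-∀)
open import Data.Product using (∃; ∃-syntax; ∃₂; _,_; proj₁; proj₂)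
open import Data.Sum using (inj₁; inj₂; [_,_]′)
open import Data.Vec using (there)
open import Function using (_∘_; id; mk⇔)
open import Level using (0ℓ)
open import Relation.Binary.Definitions using (tri<; tri≈; tri>)
open import Relation.Binary.PropositionalEquality using (_≢_; refl; sym; trans; cong; cong₂; subst; module ≡-Reasoning)
import Relation.Binary.Reasoning.Setoid as SetoidReasoning
open import Relation.Binary.Structures using (IsEquivalence)
open import Relation.Nullary using (Dec; yes; no; contradiction)
open import Relation.Nullary.Decidable using (_×-dec_; ¬?; from-no)
open import Relation.Unary using (Decidable)

-- Congruences of natural numbers

-- Where t comes from: a nonprincipal character maps `D` to a root of X² = β X + (k - μ). Its
-- discriminant β² + 4(k - μ) equals (4p)² because (β + 1)² + 7 = 16p, so the roots are -t and 4p -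
-- t. Hence such characters take only the values 0 and 4p on E, and E² involves E and G but no
-- multiple of e; this keeps every power of E in the span of E and G. As t is nonnegative, E has
-- natural coefficients. Everything can therefore be done in group rings over ℕ, where a congruence
-- modulo q is an equality after adding multiples of q to both sides. Why p - 1 roots of unity: they
-- form a group of exponents that is trivial modulo 8, so N is fixed pointwise, and whose members
-- are distinct modulo p, so off N every orbit is full. Thus |D ∩ N| inherits the residue of k
-- modulo p - 1. The factors 4y + 1 and y + 1 are then read separately: |D ∩ N| is divisible by one
-- of them and is 3 modulo the other, which conflicts with |D ∩ N| ≤ 7 unless the factors are small.

data _≈[_]_ (a q b : ℕ) : Set where
  shift : ∀ i j → a + i * q ≡ b + j * q → a ≈[ q ] b

module Congruence (q : ℕ) where

  ≈-reflexive : ∀ {a b} → a ≡ b → a ≈[ q ] b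
  ≈-reflexive eq = shift 0 0 (cong (_+ 0) eq)

  ≈-refl : ∀ {a} → a ≈[ q ] a
  ≈-refl = ≈-reflexive refl

  ≈-sym : ∀ {a b} → a ≈[ q ] b → b ≈[ q ] a
  ≈-sym (shift i j eq) = shift j i (sym eq)

  ≈-trans : ∀ {a b c} → a ≈[ q ] b → b ≈[ q ] c → a ≈[ q ] c
  ≈-trans {a} {b} {c} (shift i j eq) (shift k l eq′) = shift (i + k) (j + l) (begin
    a + (i + k) * q       ≡⟨ split a i k q ⟩
    (a + i * q) + k * q   ≡⟨ cong (_+ k * q) eq ⟩
    (b + j * q) + k * q   ≡⟨ swap b j k q ⟩
    (b + k * q) + j * q   ≡⟨ cong (_+ j * q) eq′ ⟩
    (c + l * q) + j * q   ≡⟨ swap c l j q ⟩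
    (c + j * q) + l * q   ≡⟨ split c j l q ⟨
    c + (j + l) * q       ∎)
    where
    open ≡-Reasoning
    split : ∀ a i k q → a + (i + k) * q ≡ (a + i * q) + k * q
    split = solve-∀
    swap : ∀ a i k q → (a + i * q) + k * q ≡ (a + k * q) + i * q
    swap = solve-∀

  +-cong-≈ : ∀ {a b c d} → a ≈[ q ] b → c ≈[ q ] d → (a + c) ≈[ q ] (b + d)
  +-cong-≈ {a} {b} {c} {d} (shift i j eq) (shift k l eq′) = shift (i + k) (j + l) (begin
    a + c + (i + k) * q          ≡⟨ regroup a c i k q ⟩
    (a + i * q) + (c + k * q)    ≡⟨ cong₂ _+_ eq eq′ ⟩
    (b + j * q) + (d + l * q)    ≡⟨ regroup b d j l q ⟨
    b + d + (j + l) * q          ∎)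
    where
    open ≡-Reasoning
    regroup : ∀ a c i k q → a + c + (i + k) * q ≡ (a + i * q) + (c + k * q)
    regroup = solve-∀

  *-cong-≈ : ∀ {a b c d} → a ≈[ q ] b → c ≈[ q ] d → (a * c) ≈[ q ] (b * d)
  *-cong-≈ {a} {b} {c} {d} (shift i j eq) (shift k l eq′) =
    shift (a * k + i * c + i * k * q) (b * l + j * d + j * l * q) (begin
    a * c + (a * k + i * c + i * k * q) * q   ≡⟨ expand a c i k q ⟨
    (a + i * q) * (c + k * q)                 ≡⟨ cong₂ _*_ eq eq′ ⟩
    (b + j * q) * (d + l * q)                 ≡⟨ expand b d j l q ⟩
    b * d + (b * l + j * d + j * l * q) * q   ∎)
    where
    open ≡-Reasoning
    expand : ∀ a c i k q → (a + i * q) * (c + k * q) ≡ a * c + (a * k + i * c + i * k * q) * q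
    expand = solve-∀

  +-cancelˡ-≈ : ∀ a {b c} → (a + b) ≈[ q ] (a + c) → b ≈[ q ] c
  +-cancelˡ-≈ a {b} {c} (shift i j eq) = shift i j (ℕ.+-cancelˡ-≡ a _ _
    (trans (sym (ℕ.+-assoc a b (i * q))) (trans eq (ℕ.+-assoc a c (j * q)))))

  ∣⇒≈0 : ∀ {a} → q ∣ a → a ≈[ q ] 0
  ∣⇒≈0 (divides k eq) = shift 0 k (trans (ℕ.+-identityʳ _) eq)

  ≈0⇒∣ : ∀ {a} → a ≈[ q ] 0 → q ∣ a
  ≈0⇒∣ {a} (shift i j eq) = ∣m+n∣m⇒∣n (subst (q ∣_) (trans (sym eq) (ℕ.+-comm a _)) (n∣m*n j)) (n∣m*n i)

  -- In this form the library's binomial theorem and the group ring construction apply to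
  -- coefficients modulo `q`.
  modSemiring : CommutativeSemiring 0ℓ 0ℓ
  modSemiring = record
    { Carrier = ℕ ; _≈_ = λ a b → a ≈[ q ] b ; _+_ = _+_ ; _*_ = _*_ ; 0# = 0 ; 1# = 1
    ; isCommutativeSemiring = IsCommutativeSemiringˡ.isCommutativeSemiring record
      { +-isCommutativeMonoid = record
        { isMonoid = record
          { isSemigroup = record
            { isMagma = record { isEquivalence = isEquivalence ; ∙-cong = +-cong-≈ }
            ; assoc = λ a b c → ≈-reflexive (ℕ.+-assoc a b c) }
          ; identity = (λ a → ≈-refl) , (λ a → ≈-reflexive (ℕ.+-identityʳ a)) }
        ; comm = λ a b → ≈-reflexive (ℕ.+-comm a b) }
      ; *-isCommutativeMonoid = record
        { isMonoid = record
          { isSemigroup = record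
            { isMagma = record { isEquivalence = isEquivalence ; ∙-cong = *-cong-≈ }
            ; assoc = λ a b c → ≈-reflexive (ℕ.*-assoc a b c) }
          ; identity = (λ a → ≈-reflexive (ℕ.+-identityʳ a)) , (λ a → ≈-reflexive (ℕ.*-identityʳ a)) }
        ; comm = λ a b → ≈-reflexive (ℕ.*-comm a b) }
      ; distribʳ = λ a b c → ≈-reflexive (ℕ.*-distribʳ-+ a b c)
      ; zeroˡ = λ a → ≈-refl } }
    where
    isEquivalence : IsEquivalence (λ a b → a ≈[ q ] b)
    isEquivalence = record { refl = ≈-refl ; sym = ≈-sym ; trans = ≈-trans }

-- The Frobenius endomorphism

prime∤! : ∀ {p} → Prime p → ∀ m → m < p → ¬ p ∣ m !
prime∤! pr zero    m<p p∣1 = >⇒∤ (N.nonTrivial⇒n>1 _ {{prime⇒nonTrivial pr}}) p∣1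
prime∤! pr (suc m) m<p p∣  = [ >⇒∤ m<p , prime∤! pr m (<-trans (n<1+n m) m<p) ]′
  (euclidsLemma (suc m) (m !) pr p∣)

prime∣C : ∀ {p} → Prime p → ∀ k → 0 < k → k < p → p ∣ p C k
prime∣C {p} pr k@(suc k-1) 0<k k<p with euclidsLemma (p C k) (k ! * (p ∸ k) !) pr p∣product
  where
  instance
    _ = k !* (p ∸ k) !≢0
  p∣p! : ∀ {p} → Prime p → p ∣ p !
  p∣p! {zero}  pr = contradiction (prime⇒nonZero pr) (λ ())
  p∣p! {suc n} _  = m∣m*n (n !)
  p∣product : p ∣ (p C k) * (k ! * (p ∸ k) !)
  p∣product = subst (p ∣_) (sym (trans (cong (_* (k ! * (p ∸ k) !)) (nCk≡n!/k![n-k]! (<⇒≤ k<p)))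
    (m/n*n≡m (k![n∸k]!∣n! (<⇒≤ k<p))))) (p∣p! pr)
... | inj₁ p∣C = p∣C
... | inj₂ p∣  = contradiction p∣ λ p∣ → [ prime∤! pr k k<p , prime∤! pr (p ∸ k) (∸-monoʳ-< {p} {k} {0} 0<k (<⇒≤ k<p)) ]′
  (euclidsLemma (k !) ((p ∸ k) !) pr p∣)

module Frobenius {c ℓ} (S : CommutativeSemiring c ℓ) where
  open CommutativeSemiring S renaming (_+_ to _⊕_; _*_ to _⊗_; refl to ≈-refl; trans to ≈-trans; sym to ≈-sym)
  open Exp semiring using () renaming (_^_ to _↑_)
  open Mult semiring using () renaming (_×_ to _·_; ×-assocˡ to ·-assocˡ)
  open Sum semiring using (sum; sum-cong-≋; sum-replicate-zero; sum-init-last)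
  open Binomial S using (theorem; binomialTerm)
  open SetoidReasoning setoid

  0^n≈0 : ∀ n .{{_ : NonZero n}} → 0# ↑ n ≈ 0#
  0^n≈0 (suc n) = zeroˡ _

  module _ {q} (q-prime : Prime q) (char : ∀ x → q · x ≈ 0#) where

    ∣⇒·≈0 : ∀ {n} x → q ∣ n → n · x ≈ 0#
    ∣⇒·≈0 x (divides k refl) = begin
      (k * q) · x   ≡⟨ cong (_· x) (ℕ.*-comm k q) ⟩
      (q * k) · x   ≈⟨ ·-assocˡ x q k ⟨
      q · (k · x)   ≈⟨ char (k · x) ⟩
      0#            ∎

    -- All inner binomial terms vanish. There are two instances: ℕ modulo `q`, which yields Fermat's
    -- little theorem, and the group ring modulo `q`, which yields the q-th power of a group ring
    -- element.
    ^-distrib-+ : ∀ x y → (x ⊕ y) ↑ q ≈ x ↑ q ⊕ y ↑ q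
    ^-distrib-+ x y = ≈-trans (theorem q x y) (expansion q refl)
      where
      outer : ∀ n x → n ≡ 1 → n · x ≈ x
      outer _ x refl = +-identityʳ x

      expansion : ∀ n → n ≡ q → sum (binomialTerm x y n) ≈ x ↑ n ⊕ y ↑ n
      expansion zero    n≡q = contradiction (subst NonZero (sym n≡q) (prime⇒nonZero q-prime)) λ ()
      expansion (suc r) refl = begin
        b Fin.zero ⊕ sum (λ i → b (Fin.suc i))
          ≈⟨ +-congˡ (sum-init-last (λ i → b (Fin.suc i))) ⟩
        b Fin.zero ⊕ (sum (λ i → b (Fin.suc (inject₁ i))) ⊕ b (Fin.suc (fromℕ r)))
          ≈⟨ +-congˡ (+-congʳ (≈-trans (sum-cong-≋ inner) (sum-replicate-zero r))) ⟩
        b Fin.zero ⊕ (0# ⊕ b (Fin.suc (fromℕ r)))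
          ≈⟨ +-cong (≈-trans (outer _ _ refl) (*-identityˡ _)) (+-identityˡ _) ⟩
        y ↑ suc r ⊕ b (Fin.suc (fromℕ r))
          ≈⟨ +-congˡ (last (toℕ (fromℕ r)) (toℕ-fromℕ r)) ⟩
        y ↑ suc r ⊕ x ↑ suc r
          ≈⟨ +-comm _ _ ⟩
        x ↑ suc r ⊕ y ↑ suc r ∎
        where
        b = binomialTerm x y (suc r)
        inner : ∀ i → b (Fin.suc (inject₁ i)) ≈ 0#
        inner i = ∣⇒·≈0 _ (prime∣C q-prime _ z<s (s<s (subst (_< r) (sym (toℕ-inject₁ i)) (toℕ<n i))))
        last : ∀ m → m ≡ r → (suc r C suc m) · (x ↑ suc m ⊗ y ↑ (r ∸ m)) ≈ x ↑ suc r
        last m refl = ≈-trans (outer _ _ (nCn≡1 (suc m))) (≈-trans (*-congˡ (reflexive (cong (y ↑_) (n∸n≡0 m)))) (*-identityʳ _))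

    ^-distrib-sum : ∀ {n} (f : Fin n → Carrier) → sum f ↑ q ≈ sum (λ i → f i ↑ q)
    ^-distrib-sum {zero}  f = 0^n≈0 q {{prime⇒nonZero q-prime}}
    ^-distrib-sum {suc n} f = ≈-trans (^-distrib-+ _ _) (+-congˡ (^-distrib-sum (λ i → f (Fin.suc i))))

-- Finite Abelian groups

module FiniteAbelianGroup {v : ℕ} {_∙_ : Op₂ (Fin v)} {ε : Fin v} {_⁻¹ : Op₁ (Fin v)}
  (isAbelianGroup : IsAbelianGroup _≡_ _∙_ ε _⁻¹) where

  abelianGroup : AbelianGroup 0ℓ 0ℓ
  abelianGroup = record { isAbelianGroup = isAbelianGroup }

  open AbelianGroup abelianGroup using (group; monoid; commutativeMonoid; assoc; comm; identityˡ; identityʳ; inverseˡ; inverseʳ)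
  open GroupProperties group
  open CommutativeMult commutativeMonoid using () renaming (×-distrib-+ to •-distrib-∙) public
  open MonoidMult monoid using () renaming (_×_ to _•_; ×-homo-+ to •-homo-+; ×-assocˡ to •-assoc; ×-homo-1 to •-identity) public
  open ≡-Reasoning

  x∙y⁻¹∙y≡x : ∀ x y → ((x ∙ (y ⁻¹)) ∙ y) ≡ x
  x∙y⁻¹∙y≡x x y = trans (assoc x (y ⁻¹) y) (trans (cong (x ∙_) (inverseˡ y)) (identityʳ x))

  x∙y∙y⁻¹≡x : ∀ x y → ((x ∙ y) ∙ (y ⁻¹)) ≡ x
  x∙y∙y⁻¹≡x x y = trans (assoc x y (y ⁻¹)) (trans (cong (x ∙_) (inverseʳ y)) (identityʳ x))

  x∙[x∙y⁻¹]⁻¹≡y : ∀ x y → (x ∙ ((x ∙ (y ⁻¹)) ⁻¹)) ≡ y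
  x∙[x∙y⁻¹]⁻¹≡y x y = begin
    x ∙ ((x ∙ (y ⁻¹)) ⁻¹)           ≡⟨ cong (x ∙_) (⁻¹-anti-homo-∙ x (y ⁻¹)) ⟩
    x ∙ (((y ⁻¹) ⁻¹) ∙ (x ⁻¹))      ≡⟨ cong (λ z → x ∙ (z ∙ (x ⁻¹))) (⁻¹-involutive y) ⟩
    x ∙ (y ∙ (x ⁻¹))                ≡⟨ cong (x ∙_) (comm y (x ⁻¹)) ⟩
    x ∙ ((x ⁻¹) ∙ y)                ≡⟨ assoc x (x ⁻¹) y ⟨
    (x ∙ (x ⁻¹)) ∙ y                ≡⟨ cong (_∙ y) (inverseʳ x) ⟩
    ε ∙ y                           ≡⟨ identityˡ y ⟩
    y                               ∎

  translation : Fin v → Permutation v v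
  translation a = permutation (_∙ a) (_∙ (a ⁻¹)) (λ x → x∙y⁻¹∙y≡x x a) (λ x → x∙y∙y⁻¹≡x x a)

  reflection : Fin v → Permutation v v
  reflection a = permutation (λ x → a ∙ (x ⁻¹)) (λ x → a ∙ (x ⁻¹)) (x∙[x∙y⁻¹]⁻¹≡y a) (x∙[x∙y⁻¹]⁻¹≡y a)

  •-ε : ∀ n → (n • ε) ≡ ε
  •-ε zero    = refl
  •-ε (suc n) = trans (identityˡ _) (•-ε n)

  •-⁻¹ : ∀ n x → (n • (x ⁻¹)) ≡ ((n • x) ⁻¹)
  •-⁻¹ n x = inverseˡ-unique (n • (x ⁻¹)) (n • x)
    (trans (sym (•-distrib-∙ (x ⁻¹) x n)) (trans (cong (n •_) (inverseˡ x)) (•-ε n)))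

  •-comm : ∀ m n x → (m • (n • x)) ≡ (n • (m • x))
  •-comm m n x = trans (•-assoc x m n) (trans (cong (_• x) (ℕ.*-comm m n)) (sym (•-assoc x n m)))

  ∣⇒•≡ε : ∀ {m n} x → m ∣ n → (m • x) ≡ ε → (n • x) ≡ ε
  ∣⇒•≡ε {m} x (divides k refl) eq = trans (sym (•-assoc x k m)) (trans (cong (k •_) eq) (•-ε k))

  -- Multiplying by x permutes the factors of the product of all group elements.
  order•x≡ε : ∀ x → (v • x) ≡ ε
  order•x≡ε x = identityʳ-unique (sum id) (v • x) (begin
    sum id ∙ (v • x)             ≡⟨ cong (sum id ∙_) (sum-replicate v) ⟨
    sum id ∙ sum {v} (λ _ → x)   ≡⟨ ∑-distrib-+ id (λ _ → x) ⟨
    sum (_∙ x)                   ≡⟨ sum-permute id (translation x) ⟨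
    sum id                       ∎)
    where open CommutativeSum commutativeMonoid

  •-gcd : ∀ m n x → (m • x) ≡ ε → (n • x) ≡ ε → (gcd m n • x) ≡ ε
  •-gcd m n x mx nx with Bézout.identity (gcd-GCD m n)
  ... | Bézout.+- a b eq = begin
    gcd m n • x                     ≡⟨ identityʳ _ ⟨
    (gcd m n • x) ∙ ε               ≡⟨ cong ((gcd m n • x) ∙_) (∣⇒•≡ε x (n∣m*n b) nx) ⟨
    (gcd m n • x) ∙ ((b * n) • x)   ≡⟨ •-homo-+ x (gcd m n) (b * n) ⟨
    (gcd m n + b * n) • x           ≡⟨ cong (_• x) eq ⟩
    (a * m) • x                     ≡⟨ ∣⇒•≡ε x (n∣m*n a) mx ⟩
    ε                               ∎
  ... | Bézout.-+ a b eq = begin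
    gcd m n • x                     ≡⟨ identityʳ _ ⟨
    (gcd m n • x) ∙ ε               ≡⟨ cong ((gcd m n • x) ∙_) (∣⇒•≡ε x (n∣m*n a) mx) ⟨
    (gcd m n • x) ∙ ((a * m) • x)   ≡⟨ •-homo-+ x (gcd m n) (a * m) ⟨
    (gcd m n + a * m) • x           ≡⟨ cong (_• x) eq ⟩
    (b * n) • x                     ≡⟨ ∣⇒•≡ε x (n∣m*n b) nx ⟩
    ε                               ∎

  coprime-•≡ε : ∀ {m n} x → Coprime m n → (m • x) ≡ ε → (n • x) ≡ ε → x ≡ ε
  coprime-•≡ε {m} {n} x c mx nx = begin
    x             ≡⟨ •-identity x ⟨
    1 • x         ≡⟨ cong (_• x) (coprime⇒gcd≡1 c) ⟨
    gcd m n • x   ≡⟨ •-gcd m n x mx nx ⟩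
    ε             ∎

  •-injective : ∀ {n} → Coprime n v → ∀ {x y} → (n • x) ≡ (n • y) → x ≡ y
  •-injective {n} c {x} {y} eq = x∙y⁻¹≈ε⇒x≈y x y (coprime-•≡ε _ c (begin
    n • (x ∙ (y ⁻¹))          ≡⟨ •-distrib-∙ x (y ⁻¹) n ⟩
    (n • x) ∙ (n • (y ⁻¹))    ≡⟨ cong₂ _∙_ eq (•-⁻¹ n y) ⟩
    (n • y) ∙ ((n • y) ⁻¹)    ≡⟨ inverseʳ _ ⟩
    ε                         ∎) (order•x≡ε _))

-- Group rings

𝟙 : ∀ {a} {A : Set a} → Dec A → ℕ
𝟙 (yes _) = 1
𝟙 (no _)  = 0

𝟙-cong : ∀ {a b} {A : Set a} {B : Set b} (A? : Dec A) (B? : Dec B) → (A → B) → (B → A) → 𝟙 A? ≡ 𝟙 B?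
𝟙-cong (yes a) (yes b) f g = refl
𝟙-cong (yes a) (no ¬b) f g = contradiction (f a) ¬b
𝟙-cong (no ¬a) (yes b) f g = contradiction (g b) ¬a
𝟙-cong (no ¬a) (no ¬b) f g = refl

module GroupRing {c ℓ} (R : CommutativeSemiring c ℓ)
  {v : ℕ} {_∙_ : Op₂ (Fin v)} {ε : Fin v} {_⁻¹ : Op₁ (Fin v)}
  (isAbelianGroup : IsAbelianGroup _≡_ _∙_ ε _⁻¹) where

  open CommutativeSemiring R renaming (_+_ to _⊕_; _*_ to _⊗_; refl to ≈-refl; trans to ≈-trans; sym to ≈-sym)
  open Sum semiring
  open Exp semiring using () renaming (_^_ to _↑_)
  open Mult semiring using () renaming (_×_ to _·_)
  open IsAbelianGroup isAbelianGroup using () renaming (assoc to ∙-assoc; comm to ∙-comm; identityʳ to ∙-identityʳ)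
  open FiniteAbelianGroup isAbelianGroup
  open GroupProperties (AbelianGroup.group abelianGroup) using (⁻¹-anti-homo-∙)
  open SetoidReasoning setoid

  δ : Fin v → Fin v → Carrier
  δ a x with a ≟ x
  ... | yes _ = 1#
  ... | no  _ = 0#

  δ-cong : ∀ a x b y → (a ≡ x → b ≡ y) → (b ≡ y → a ≡ x) → δ a x ≡ δ b y
  δ-cong a x b y f g with a ≟ x | b ≟ y
  ... | yes p | yes q = refl
  ... | yes p | no ¬q = contradiction (f p) ¬q
  ... | no ¬p | yes q = contradiction (g q) ¬p
  ... | no ¬p | no ¬q = refl

  -- Stated for any `d` that behaves like a delta at `a`, so that it serves both `δ` and the
  -- indicators `𝟙 (a ≟ g)`.
  sum-δ : ∀ {n} (g : Fin n → Carrier) a (d : Fin n → Carrier) →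
    d a ≈ 1# → (∀ h → a ≢ h → d h ≈ 0#) → sum (λ h → d h ⊗ g h) ≈ g a
  sum-δ {suc n} g Fin.zero d one other = begin
    d Fin.zero ⊗ g Fin.zero ⊕ sum (λ h → d (Fin.suc h) ⊗ g (Fin.suc h))
      ≈⟨ +-cong (≈-trans (*-congʳ one) (*-identityˡ _))
           (≈-trans (sum-cong-≋ λ h → ≈-trans (*-congʳ (other (Fin.suc h) λ ())) (zeroˡ _)) (sum-replicate-zero n)) ⟩
    g Fin.zero ⊕ 0#
      ≈⟨ +-identityʳ _ ⟩
    g Fin.zero ∎
  sum-δ {suc n} g (Fin.suc a) d one other = begin
    d Fin.zero ⊗ g Fin.zero ⊕ sum (λ h → d (Fin.suc h) ⊗ g (Fin.suc h))
      ≈⟨ +-cong (≈-trans (*-congʳ (other Fin.zero λ ())) (zeroˡ _))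
           (sum-δ (g ∘ Fin.suc) a (d ∘ Fin.suc) one (λ h a≢h → other (Fin.suc h) λ { refl → a≢h refl })) ⟩
    0# ⊕ g (Fin.suc a)
      ≈⟨ +-identityˡ _ ⟩
    g (Fin.suc a) ∎

  ∑-δ : ∀ a (g : Fin v → Carrier) → sum (λ h → δ a h ⊗ g h) ≈ g a
  ∑-δ a g = sum-δ g a (δ a) one other
    where
    one : δ a a ≈ 1#
    one with a ≟ a
    ... | yes _  = ≈-refl
    ... | no a≢a = contradiction refl a≢a
    other : ∀ h → a ≢ h → δ a h ≈ 0#
    other h a≢h with a ≟ h
    ... | yes a≡h = contradiction a≡h a≢h
    ... | no _    = ≈-refl

  infixl 7 _✶_
  -- Convolution: the product of group ring elements given by their coefficient functions.
  _✶_ : (f g : Fin v → Carrier) → Fin v → Carrier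
  (f ✶ g) x = sum (λ h → f (x ∙ (h ⁻¹)) ⊗ g h)

  δ-shift : ∀ a x h → δ a (x ∙ (h ⁻¹)) ≡ δ (x ∙ (a ⁻¹)) h
  δ-shift a x h = δ-cong a (x ∙ (h ⁻¹)) (x ∙ (a ⁻¹)) h
    (λ { refl → x∙[x∙y⁻¹]⁻¹≡y x h })
    (λ { refl → sym (x∙[x∙y⁻¹]⁻¹≡y x a) })

  δ-✶ : ∀ a g x → (δ a ✶ g) x ≈ g (x ∙ (a ⁻¹))
  δ-✶ a g x = ≈-trans (sum-cong-≋ (λ h → *-congʳ (reflexive (δ-shift a x h)))) (∑-δ _ g)

  x∙ε⁻¹≡x : ∀ x → (x ∙ (ε ⁻¹)) ≡ x
  x∙ε⁻¹≡x x = trans (sym (∙-identityʳ _)) (x∙y⁻¹∙y≡x x ε)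

  ✶-cong : ∀ {f f′ g g′} → (∀ x → f x ≈ f′ x) → (∀ x → g x ≈ g′ x) → ∀ x → (f ✶ g) x ≈ (f′ ✶ g′) x
  ✶-cong f≈ g≈ x = sum-cong-≋ (λ h → *-cong (f≈ _) (g≈ h))

  ✶-comm : ∀ f g x → (f ✶ g) x ≈ (g ✶ f) x
  ✶-comm f g x = begin
    sum (λ h → f (x ∙ (h ⁻¹)) ⊗ g h)
      ≈⟨ sum-permute (λ h → f (x ∙ (h ⁻¹)) ⊗ g h) (reflection x) ⟩
    sum (λ h → f (x ∙ ((x ∙ (h ⁻¹)) ⁻¹)) ⊗ g (x ∙ (h ⁻¹)))
      ≈⟨ sum-cong-≋ (λ h → ≈-trans (*-congʳ (reflexive (cong f (x∙[x∙y⁻¹]⁻¹≡y x h)))) (*-comm _ _)) ⟩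
    sum (λ h → g (x ∙ (h ⁻¹)) ⊗ f h) ∎

  ✶-assoc : ∀ f g k x → ((f ✶ g) ✶ k) x ≈ (f ✶ (g ✶ k)) x
  ✶-assoc f g k x = begin
    sum (λ h → sum (λ a → f ((x ∙ (h ⁻¹)) ∙ (a ⁻¹)) ⊗ g a) ⊗ k h)
      ≈⟨ sum-cong-≋ inner ⟩
    sum (λ h → sum (λ b → f (x ∙ (b ⁻¹)) ⊗ (g (b ∙ (h ⁻¹)) ⊗ k h)))
      ≈⟨ ∑-comm (λ h b → f (x ∙ (b ⁻¹)) ⊗ (g (b ∙ (h ⁻¹)) ⊗ k h)) ⟩
    sum (λ b → sum (λ h → f (x ∙ (b ⁻¹)) ⊗ (g (b ∙ (h ⁻¹)) ⊗ k h)))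
      ≈⟨ sum-cong-≋ (λ b → *-distribˡ-sum (f (x ∙ (b ⁻¹))) (λ h → g (b ∙ (h ⁻¹)) ⊗ k h)) ⟨
    sum (λ b → f (x ∙ (b ⁻¹)) ⊗ sum (λ h → g (b ∙ (h ⁻¹)) ⊗ k h)) ∎
    where
    inner : ∀ h → sum (λ a → f ((x ∙ (h ⁻¹)) ∙ (a ⁻¹)) ⊗ g a) ⊗ k h
      ≈ sum (λ b → f (x ∙ (b ⁻¹)) ⊗ (g (b ∙ (h ⁻¹)) ⊗ k h))
    inner h = begin
      sum (λ a → f ((x ∙ (h ⁻¹)) ∙ (a ⁻¹)) ⊗ g a) ⊗ k h
        ≈⟨ *-distribʳ-sum (k h) (λ a → f ((x ∙ (h ⁻¹)) ∙ (a ⁻¹)) ⊗ g a) ⟩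
      sum (λ a → f ((x ∙ (h ⁻¹)) ∙ (a ⁻¹)) ⊗ g a ⊗ k h)
        ≈⟨ sum-cong-≋ (λ a → ≈-trans (*-assoc _ _ _) (*-cong
             (reflexive (cong f (trans (∙-assoc x (h ⁻¹) (a ⁻¹)) (cong (x ∙_) (sym (⁻¹-anti-homo-∙ a h))))))
             (*-congʳ (reflexive (cong g (sym (x∙y∙y⁻¹≡x a h))))))) ⟩
      sum (λ a → f (x ∙ ((a ∙ h) ⁻¹)) ⊗ (g ((a ∙ h) ∙ (h ⁻¹)) ⊗ k h))
        ≈⟨ sum-permute (λ b → f (x ∙ (b ⁻¹)) ⊗ (g (b ∙ (h ⁻¹)) ⊗ k h)) (translation h) ⟨
      sum (λ b → f (x ∙ (b ⁻¹)) ⊗ (g (b ∙ (h ⁻¹)) ⊗ k h)) ∎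

  ✶-identityˡ : ∀ g x → (δ ε ✶ g) x ≈ g x
  ✶-identityˡ g x = ≈-trans (δ-✶ ε g x) (reflexive (cong g (x∙ε⁻¹≡x x)))

  groupRing : CommutativeSemiring c ℓ
  groupRing = record
    { Carrier = Fin v → Carrier ; _≈_ = λ f g → ∀ x → f x ≈ g x
    ; _+_ = λ f g x → f x ⊕ g x ; _*_ = _✶_ ; 0# = λ _ → 0# ; 1# = δ ε
    ; isCommutativeSemiring = IsCommutativeSemiringˡ.isCommutativeSemiring record
      { +-isCommutativeMonoid = record
        { isMonoid = record
          { isSemigroup = record
            { isMagma = record { isEquivalence = pointwise ; ∙-cong = λ p q x → +-cong (p x) (q x) }
            ; assoc = λ f g h x → +-assoc _ _ _ }
          ; identity = (λ f x → +-identityˡ _) , (λ f x → +-identityʳ _) }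
        ; comm = λ f g x → +-comm _ _ }
      ; *-isCommutativeMonoid = record
        { isMonoid = record
          { isSemigroup = record
            { isMagma = record { isEquivalence = pointwise ; ∙-cong = ✶-cong }
            ; assoc = ✶-assoc }
          ; identity = ✶-identityˡ , (λ f x → ≈-trans (✶-comm f (δ ε) x) (✶-identityˡ f x)) }
        ; comm = ✶-comm }
      ; distribʳ = λ k f g x → ≈-trans (sum-cong-≋ {v} (λ h → distribʳ (k h) (f (x ∙ (h ⁻¹))) (g (x ∙ (h ⁻¹)))))
          (∑-distrib-+ (λ h → f (x ∙ (h ⁻¹)) ⊗ k h) (λ h → g (x ∙ (h ⁻¹)) ⊗ k h))
      ; zeroˡ = λ f x → ≈-trans (sum-cong-≋ {v} (λ h → zeroˡ (f h))) (sum-replicate-zero v) } }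
    where
    pointwise : IsEquivalence (λ (f g : Fin v → Carrier) → ∀ x → f x ≈ g x)
    pointwise = record
      { refl = λ x → ≈-refl ; sym = λ p x → ≈-sym (p x) ; trans = λ p q x → ≈-trans (p x) (q x) }

  private
    module RG = CommutativeSemiring groupRing
    module RGSum = Sum RG.semiring
    module RGMult = Mult RG.semiring
  open Exp RG.semiring using () renaming (_^_ to _⇑_; ^-congˡ to ⇑-cong) public

  sum-pointwise : ∀ {n} (F : Fin n → Fin v → Carrier) x → RGSum.sum F x ≡ sum (λ i → F i x)
  sum-pointwise {zero}  F x = refl
  sum-pointwise {suc n} F x = cong (F Fin.zero x ⊕_) (sum-pointwise (F ∘ Fin.suc) x)

  ·-pointwise : ∀ n f x → (n RGMult.× f) x ≡ n · (f x)
  ·-pointwise zero    f x = refl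
  ·-pointwise (suc n) f x = cong (f x ⊕_) (·-pointwise n f x)

  monomial : Carrier → Fin v → Fin v → Carrier
  monomial r a x = δ a x ⊗ r

  monomial-⇑ : ∀ n r a x → (monomial r a ⇑ n) x ≈ monomial (r ↑ n) (n • a) x
  monomial-⇑ zero    r a x = ≈-sym (*-identityʳ _)
  monomial-⇑ (suc n) r a x = begin
    (monomial r a ✶ (monomial r a ⇑ n)) x
      ≈⟨ sum-cong-≋ (λ h → *-congˡ (monomial-⇑ n r a h)) ⟩
    sum (λ h → (δ a (x ∙ (h ⁻¹)) ⊗ r) ⊗ (δ (n • a) h ⊗ r ↑ n))
      ≈⟨ sum-cong-≋ {v} (λ h → *-assoc _ _ _) ⟩
    (δ a ✶ (λ h → r ⊗ (δ (n • a) h ⊗ r ↑ n))) x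
      ≈⟨ δ-✶ a _ x ⟩
    r ⊗ (δ (n • a) (x ∙ (a ⁻¹)) ⊗ r ↑ n)
      ≈⟨ ≈-trans (≈-sym (*-assoc _ _ _)) (≈-trans (*-congʳ (*-comm _ _)) (*-assoc _ _ _)) ⟩
    δ (n • a) (x ∙ (a ⁻¹)) ⊗ (r ⊗ r ↑ n)
      ≈⟨ *-congʳ (reflexive (δ-cong (n • a) (x ∙ (a ⁻¹)) (suc n • a) x
           (λ eq → trans (cong (a ∙_) eq) (trans (∙-comm a _) (x∙y⁻¹∙y≡x x a)))
           (λ eq → trans (sym (x∙y∙y⁻¹≡x (n • a) a)) (cong (_∙ (a ⁻¹)) (trans (∙-comm (n • a) a) eq))))) ⟩
    δ (suc n • a) x ⊗ (r ⊗ r ↑ n) ∎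

  -- Frobenius in the group ring itself: `f` is the sum of its monomials, and each monomial is
  -- raised to the q-th power separately.
  ⇑-prime : ∀ {q} → Prime q → (∀ r → q · r ≈ 0#) → ∀ f x →
    (f ⇑ q) x ≈ sum (λ g → δ (q • g) x ⊗ f g ↑ q)
  ⇑-prime {q} q-prime char f x = begin
    (f ⇑ q) x
      ≈⟨ ⇑-cong q expand x ⟩
    (RGSum.sum (λ g → monomial (f g) g) ⇑ q) x
      ≈⟨ Frobenius.^-distrib-sum groupRing q-prime
           (λ k y → ≈-trans (reflexive (·-pointwise q k y)) (char (k y))) (λ g → monomial (f g) g) x ⟩
    RGSum.sum (λ g → monomial (f g) g ⇑ q) x
      ≡⟨ sum-pointwise (λ g → monomial (f g) g ⇑ q) x ⟩
    sum (λ g → (monomial (f g) g ⇑ q) x)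
      ≈⟨ sum-cong-≋ (λ g → monomial-⇑ q (f g) g x) ⟩
    sum (λ g → δ (q • g) x ⊗ f g ↑ q) ∎
    where
    expand : ∀ x → f x ≈ RGSum.sum (λ g → monomial (f g) g) x
    expand x = begin
      f x                                     ≈⟨ ∑-δ x f ⟨
      sum (λ g → δ x g ⊗ f g)                 ≈⟨ sum-cong-≋ {v} (λ g → *-congʳ (reflexive (δ-cong x g g x sym sym))) ⟩
      sum (λ g → monomial (f g) g x)          ≡⟨ sum-pointwise (λ g → monomial (f g) g) x ⟨
      RGSum.sum (λ g → monomial (f g) g) x    ∎

open Sum ℕ.+-*-semiring using () renaming (sum to ∑; sum-cong-≗ to ∑-cong; ∑-distrib-+ to ∑-+; *-distribˡ-sum to *-∑; sum-permute to ∑-permute; sum-replicate-zero to ∑-zero; ∑-comm to ∑-swap)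

-- Fermat's little theorem and multipliers modulo a prime

module PrimeModulus {q} (q-prime : Prime q) where
  open Congruence q
  open CommutativeSemiring modSemiring using (semiring; setoid; +-cong; *-congˡ; +-congˡ; *-congʳ)
  open Exp semiring using () renaming (_^_ to _↑_)
  open Mult semiring using () renaming (_×_ to _·_)

  ↑≡^ : ∀ n m → n ↑ m ≡ n ^ m
  ↑≡^ n zero    = refl
  ↑≡^ n (suc m) = cong (n *_) (↑≡^ n m)

  ·≡* : ∀ m n → m · n ≡ m * n
  ·≡* zero    n = refl
  ·≡* (suc m) n = cong (λ z → n + z) (·≡* m n)

  characteristic : ∀ n → (q · n) ≈[ q ] 0
  characteristic n = ≈-trans (≈-reflexive (·≡* q n)) (∣⇒≈0 (m∣m*n n))

  fermat : ∀ n → (n ^ q) ≈[ q ] n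
  fermat zero    = ≈-trans (≈-reflexive (sym (↑≡^ 0 q))) (Frobenius.0^n≈0 modSemiring q {{prime⇒nonZero q-prime}})
  fermat (suc n) = begin
    (1 + n) ^ q     ≡⟨ ↑≡^ (1 + n) q ⟨
    (1 + n) ↑ q     ≈⟨ Frobenius.^-distrib-+ modSemiring q-prime characteristic 1 n ⟩
    1 ↑ q + n ↑ q   ≡⟨ cong₂ _+_ (trans (↑≡^ 1 q) (ℕ.^-zeroˡ q)) (↑≡^ n q) ⟩
    1 + n ^ q       ≈⟨ +-congˡ {1} (fermat n) ⟩
    1 + n           ∎
    where open SetoidReasoning setoid

  module _ {v : ℕ} {_∙_ : Op₂ (Fin v)} {ε : Fin v} {_⁻¹ : Op₁ (Fin v)}
    (isAbelianGroup : IsAbelianGroup _≡_ _∙_ ε _⁻¹) where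
    open FiniteAbelianGroup isAbelianGroup
    open GroupRing modSemiring isAbelianGroup
    open Sum semiring using (sum-cong-≋)
    open SetoidReasoning setoid

    -- Injectivity of g ↦ g ^ q is asked only at `x` and on the support of `f`. This covers q
    -- coprime to v, and also q = p dividing v when `f` is supported on the Sylow 2-subgroup.
    coefficient-⇑ : ∀ f x → (∀ g → (q • g) ≡ (q • x) → f g ≢ 0 → x ≡ g) → (f ⇑ q) (q • x) ≈[ q ] f x
    coefficient-⇑ f x inj = begin
      (f ⇑ q) (q • x)                               ≈⟨ ⇑-prime q-prime characteristic f (q • x) ⟩
      ∑ (λ g → δ (q • g) (q • x) * (f g ↑ q))       ≈⟨ sum-cong-≋ {v} (λ g → *-congˡ {δ (q • g) (q • x)} (≈-trans (≈-reflexive (↑≡^ (f g) q)) (fermat (f g)))) ⟩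
      ∑ (λ g → δ (q • g) (q • x) * f g)             ≡⟨ ∑-cong term ⟩
      ∑ (λ g → δ x g * f g)                         ≈⟨ ∑-δ x f ⟩
      f x                                           ∎
      where
      term : ∀ g → δ (q • g) (q • x) * f g ≡ δ x g * f g
      term g with f g ℕ.≟ 0
      ... | yes fg≡0 rewrite fg≡0 = trans (ℕ.*-zeroʳ (δ (q • g) (q • x))) (sym (ℕ.*-zeroʳ (δ x g)))
      ... | no fg≢0 = cong (_* f g) (δ-cong (q • g) (q • x) x g (λ eq → inj g eq fg≢0) (λ eq → cong (q •_) (sym eq)))

    -- The span of f and G is closed under multiplication by f, since f G = (∑ f) G. The factor `b`
    -- stays visible in the multiple of G, so that b = 0 gives a pure multiple of f.
    power-of-quadratic : ∀ f a b → (∀ x → (f ✶ f) x ≡ a * f x + b) →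
      ∀ m → ∃[ c ] ∀ x → (f ⇑ suc m) x ≈[ q ] (a ^ m * f x + b * c)
    power-of-quadratic f a b f² zero = 0 , λ x → begin
      (f ✶ δ ε) x        ≈⟨ ≈-trans (✶-comm f (δ ε) x) (✶-identityˡ f x) ⟩
      f x                ≡⟨ unit (f x) b ⟩
      1 * f x + b * 0    ∎
      where
      unit : ∀ e b → e ≡ 1 * e + b * 0
      unit = solve-∀
    power-of-quadratic f a b f² (suc m) with power-of-quadratic f a b f² m
    ... | c , fᵐ = a ^ m + c * ∑ f , λ x → begin
      (f ✶ (f ⇑ suc m)) x
        ≈⟨ sum-cong-≋ {v} (λ h → *-congˡ {f (x ∙ (h ⁻¹))} (fᵐ h)) ⟩
      ∑ (λ h → f (x ∙ (h ⁻¹)) * (a ^ m * f h + b * c))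
        ≡⟨ ∑-cong (λ h → distribute (f (x ∙ (h ⁻¹))) (a ^ m) (f h) (b * c)) ⟩
      ∑ (λ h → a ^ m * (f (x ∙ (h ⁻¹)) * f h) + b * c * f (x ∙ (h ⁻¹)))
        ≡⟨ ∑-+ (λ h → a ^ m * (f (x ∙ (h ⁻¹)) * f h)) (λ h → b * c * f (x ∙ (h ⁻¹))) ⟩
      ∑ (λ h → a ^ m * (f (x ∙ (h ⁻¹)) * f h)) + ∑ (λ h → b * c * f (x ∙ (h ⁻¹)))
        ≡⟨ cong₂ _+_ (*-∑ (a ^ m) (λ h → f (x ∙ (h ⁻¹)) * f h)) (*-∑ (b * c) (λ h → f (x ∙ (h ⁻¹)))) ⟨
      a ^ m * (f ✶ f) x + b * c * ∑ (λ h → f (x ∙ (h ⁻¹)))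
        ≡⟨ cong₂ (λ u w → a ^ m * u + b * c * w) (f² x) (sym (∑-permute f (reflection x))) ⟩
      a ^ m * (a * f x + b) + b * c * ∑ f
        ≡⟨ collect (a ^ m) a (f x) b c (∑ f) ⟩
      a ^ suc m * f x + b * (a ^ m + c * ∑ f) ∎
      where
      distribute : ∀ e A e′ B → e * (A * e′ + B) ≡ A * (e * e′) + B * e
      distribute = solve-∀
      collect : ∀ A a e b c S → A * (a * e + b) + b * c * S ≡ a * A * e + b * (A + c * S)
      collect = solve-∀

    -- By Frobenius f ^ q is f spread over q-th powers, while f ² = a f + b G makes f ^ q a combination
    -- of f and G; comparing coefficients at ε shows that the multiple of G vanishes.
    quadratic-multiplier : Coprime q v → ∀ f a b → (∀ x → (f ✶ f) x ≡ a * f x + b) →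
      ∀ x → (a * f x) ≈[ q ] (a * f (q • x))
    quadratic-multiplier q⊥v f a b f² x = begin
      a * f x                          ≈⟨ scaled x ⟩
      a * f (q • x) + a * (b * c)      ≈⟨ +-congˡ {a * f (q • x)} constant≈0 ⟩
      a * f (q • x) + 0                ≡⟨ ℕ.+-identityʳ _ ⟩
      a * f (q • x)                    ∎
      where
      -- Multiplying by `a` replaces a ^ (q - 1), which is not 1 modulo q when q divides a, by a ^
      -- q, which is always congruent to a. This is the source of the factor `a` in the conclusion.
      expansion : ∀ r .{{_ : NonZero r}} → ∃[ c ] ∀ y → (a * (f ⇑ r) y) ≈[ q ] (a ^ r * f y + a * (b * c))
      expansion (suc m) with power-of-quadratic f a b f² m
      ... | c , fᵐ = c , λ y → ≈-trans (*-congˡ {a} (fᵐ y)) (≈-reflexive (spread a (a ^ m) (f y) (b * c)))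
        where
        spread : ∀ a A e B → a * (A * e + B) ≡ a * A * e + a * B
        spread = solve-∀
      c = proj₁ (expansion q {{prime⇒nonZero q-prime}})
      scaled : ∀ x → (a * f x) ≈[ q ] (a * f (q • x) + a * (b * c))
      scaled x = begin
        a * f x
          ≈⟨ *-congˡ {a} (coefficient-⇑ f x (λ g eq _ → •-injective q⊥v (sym eq))) ⟨
        a * (f ⇑ q) (q • x)
          ≈⟨ proj₂ (expansion q {{prime⇒nonZero q-prime}}) (q • x) ⟩
        a ^ q * f (q • x) + a * (b * c)
          ≈⟨ +-cong (*-congʳ {f (q • x)} (fermat a)) (≈-refl {a * (b * c)}) ⟩
        a * f (q • x) + a * (b * c) ∎
      constant≈0 : (a * (b * c)) ≈[ q ] 0
      constant≈0 = ≈-sym (+-cancelˡ-≈ (a * f ε) (begin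
        a * f ε + 0                     ≡⟨ ℕ.+-identityʳ _ ⟩
        a * f ε                         ≈⟨ scaled ε ⟩
        a * f (q • ε) + a * (b * c)     ≡⟨ cong (λ y → a * f y + a * (b * c)) (•-ε q) ⟩
        a * f ε + a * (b * c)           ∎))

-- Counting

length-unique : ∀ {A : Set} {xs ys : List A} → Unique xs → Unique ys →
  (∀ {z} → z ∈ₗ xs → z ∈ₗ ys) → (∀ {z} → z ∈ₗ ys → z ∈ₗ xs) → length xs ≡ length ys
length-unique xs! ys! to from = ↭-length (∼bag⇒↭ (unique∧set⇒bag xs! ys! (mk⇔ to from)))

∑-𝟙-tabulate : ∀ {A : Set} {P : A → Set} (P? : Decidable P) {n} (f : Fin n → A) →
  ∑ (λ i → 𝟙 (P? (f i))) ≡ length (filter P? (tabulate f))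
∑-𝟙-tabulate P? {zero}  f = refl
∑-𝟙-tabulate P? {suc n} f with P? (f Fin.zero)
... | yes _ = cong suc (∑-𝟙-tabulate P? (f ∘ Fin.suc))
... | no _  = ∑-𝟙-tabulate P? (f ∘ Fin.suc)

∑-𝟙 : ∀ {n} {P : Fin n → Set} (P? : Decidable P) → ∑ (λ i → 𝟙 (P? i)) ≡ length (filter P? (allFin n))
∑-𝟙 P? = ∑-𝟙-tabulate P? id

∑-𝟙-∈ : ∀ {n} (D : Subset n) → ∑ (λ i → 𝟙 (i ∈? D)) ≡ ∣ D ∣
∑-𝟙-∈ Data.Vec.[] = refl
∑-𝟙-∈ (inside Data.Vec.∷ D) = cong suc (trans
  (∑-cong (λ i → 𝟙-cong (Fin.suc i ∈? (inside Data.Vec.∷ D)) (i ∈? D) drop-there there)) (∑-𝟙-∈ D))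
∑-𝟙-∈ (outside Data.Vec.∷ D) = trans
  (∑-cong (λ i → 𝟙-cong (Fin.suc i ∈? (outside Data.Vec.∷ D)) (i ∈? D) drop-there there)) (∑-𝟙-∈ D)

𝟙-× : ∀ {A B : Set} (A? : Dec A) (B? : Dec B) → 𝟙 A? * 𝟙 B? ≡ 𝟙 (A? ×-dec B?)
𝟙-× (yes _) (yes _) = refl
𝟙-× (yes _) (no _)  = refl
𝟙-× (no _)  _       = refl

∑-mono : ∀ {n} (f g : Fin n → ℕ) → (∀ i → f i ≤ g i) → ∑ f ≤ ∑ g
∑-mono {zero}  f g f≤g = z≤n
∑-mono {suc n} f g f≤g = ℕ.+-mono-≤ (f≤g Fin.zero) (∑-mono (f ∘ Fin.suc) (g ∘ Fin.suc) (f≤g ∘ Fin.suc))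

∑-𝟙-split : ∀ {n} {P Q : Fin n → Set} (P? : Decidable P) (Q? : Decidable Q) →
  ∑ (λ i → 𝟙 (P? i)) ≡ ∑ (λ i → 𝟙 (P? i ×-dec Q? i)) + ∑ (λ i → 𝟙 (P? i ×-dec ¬? (Q? i)))
∑-𝟙-split {n} P? Q? = trans (∑-cong split) (∑-+ (λ i → 𝟙 (P? i ×-dec Q? i)) (λ i → 𝟙 (P? i ×-dec ¬? (Q? i))))
  where
  split : ∀ i → 𝟙 (P? i) ≡ 𝟙 (P? i ×-dec Q? i) + 𝟙 (P? i ×-dec ¬? (Q? i))
  split i with P? i | Q? i
  ... | yes _ | yes _ = refl
  ... | yes _ | no _  = refl
  ... | no _  | yes _ = refl
  ... | no _  | no _  = refl

-- Orbits

length-filter-split : ∀ {A : Set} {P : A → Set} (P? : Decidable P) xs →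
  length xs ≡ length (filter P? xs) + length (filter (¬? ∘ P?) xs)
length-filter-split P? []       = refl
length-filter-split P? (x ∷ xs) with P? x
... | yes _ = cong suc (length-filter-split P? xs)
... | no _  = trans (cong suc (length-filter-split P? xs)) (sym (ℕ.+-suc _ _))

module _ {n} (orbit : Fin n → List (Fin n))
  (orbit-refl : ∀ x → x ∈ₗ orbit x)
  (orbit-sym : ∀ {x y} → y ∈ₗ orbit x → x ∈ₗ orbit y)
  (orbit-trans : ∀ {x y z} → y ∈ₗ orbit x → z ∈ₗ orbit y → z ∈ₗ orbit x) where
  open DecMembership {A = Fin n} _≟_ using () renaming (_∈?_ to _∈ₗ?_)

  -- Strip off the orbit of the head: symmetry and transitivity keep the remaining list a union of
  -- orbits.
  orbit-size∣length : ∀ {m} xs → Unique xs →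
    (∀ {x} → x ∈ₗ xs → Unique (orbit x) × length (orbit x) ≡ m) →
    (∀ {x y} → x ∈ₗ xs → y ∈ₗ orbit x → y ∈ₗ xs) → m ∣ length xs
  orbit-size∣length {m} xs = go (length xs) xs ℕ.≤-refl
    where
    -- Removing an orbit is not a structural descent, so the recursion runs on a bound for the
    -- length.
    go : ∀ fuel xs → length xs ≤ fuel → Unique xs →
      (∀ {x} → x ∈ₗ xs → Unique (orbit x) × length (orbit x) ≡ m) →
      (∀ {x y} → x ∈ₗ xs → y ∈ₗ orbit x → y ∈ₗ xs) → m ∣ length xs
    go fuel []       _ _ _ _ = m ∣0
    go zero (x ∷ xs) () _ _ _
    go (suc fuel) (x ∷ xs) bound xs! orbits closed =
      subst (m ∣_) (sym (length-filter-split P? (x ∷ xs))) (∣m∣n⇒∣m+n (∣-reflexive (sym m≡)) m∣rest)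
      where
      P? : Decidable (_∈ₗ orbit x)
      P? = _∈ₗ? orbit x
      rest = filter (¬? ∘ P?) (x ∷ xs)
      m≡ : length (filter P? (x ∷ xs)) ≡ m
      m≡ = trans (length-unique (filter-unique P? xs!) (proj₁ (orbits (hereₗ refl)))
        (λ z∈ → proj₂ (∈-filter⁻ P? {xs = x ∷ xs} z∈)) (λ z∈ → ∈-filter⁺ P? (closed (hereₗ refl) z∈) z∈))
        (proj₂ (orbits (hereₗ refl)))
      m∣rest : m ∣ length rest
      m∣rest = go fuel rest
        (N.s≤s⁻¹ (ℕ.<-≤-trans (filter-notAll (¬? ∘ P?) (x ∷ xs) (hereₗ (λ x∉ → x∉ (orbit-refl x)))) bound))
        (filter-unique (¬? ∘ P?) xs!)
        (λ y∈ → orbits (proj₁ (∈-filter⁻ (¬? ∘ P?) {xs = x ∷ xs} y∈)))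
        (λ {y} y∈ z∈ → let y∈xs , y∉ = ∈-filter⁻ (¬? ∘ P?) {xs = x ∷ xs} y∈ in
          ∈-filter⁺ (¬? ∘ P?) (closed y∈xs z∈) (λ z∈′ → y∉ (orbit-trans z∈′ (orbit-sym z∈))))

-- Arithmetic modulo prime powers

coprime-* : ∀ {n a b} → Coprime n a → Coprime n b → Coprime n (a * b)
coprime-* n⊥a n⊥b (d∣n , d∣ab) =
  n⊥b (d∣n , coprime-divisor (λ (e∣d , e∣a) → n⊥a (∣-trans e∣d d∣n , e∣a)) d∣ab)

coprime-^ : ∀ {n a} → Coprime n a → ∀ m → Coprime n (a ^ m)
coprime-^ n⊥a zero    (_ , d∣1) = ∣1⇒≡1 d∣1
coprime-^ n⊥a (suc m) = coprime-* n⊥a (coprime-^ n⊥a m)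

∤prime⇒coprime : ∀ {n p} → Prime p → ¬ p ∣ n → Coprime n p
∤prime⇒coprime p-prime p∤n (d∣n , d∣p) with prime⇒irreducible p-prime d∣p
... | inj₁ d≡1  = d≡1
... | inj₂ refl = contradiction d∣n p∤n

prime∤1 : ∀ {p} → Prime p → ¬ p ∣ 1
prime∤1 p-prime = >⇒∤ (N.nonTrivial⇒n>1 _ {{prime⇒nonTrivial p-prime}})

prime∤^ : ∀ {p} → Prime p → ∀ {a} → ¬ p ∣ a → ∀ m → ¬ p ∣ a ^ m
prime∤^ p-prime p∤a zero    = prime∤1 p-prime
prime∤^ p-prime p∤a (suc m) p∣ = [ p∤a , prime∤^ p-prime p∤a m ]′ (euclidsLemma _ _ p-prime p∣)

-- A Taylor expansion to first order with an unspecified remainder; the exponent `suc m` keeps its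
-- derivative free of truncated subtraction.
binomial-mod-square : ∀ m a e → ∃[ r ] (a + e) ^ suc m ≡ a ^ suc m + suc m * e * a ^ m + e * e * r
binomial-mod-square zero    a e = 0 , base a e
  where
  base : ∀ a e → (a + e) * 1 ≡ a * 1 + 1 * e * 1 + e * e * 0
  base = solve-∀
binomial-mod-square (suc m) a e with binomial-mod-square m a e
... | r , eq = suc m * a ^ m + a * r + e * r , trans (cong ((a + e) *_) eq) (step a e (a ^ m) (suc m) r)
  where
  step : ∀ a e A m r → (a + e) * (a * A + m * e * A + e * e * r) ≡
    a * (a * A) + (1 + m) * e * (a * A) + e * e * (m * A + a * r + e * r)
  step = solve-∀

-- In (a + i n) ^ p the linear term carries the factor p n, and the rest carries n², a multiple of p
-- n because p divides n.
^-lift-≈ : ∀ p .{{_ : NonZero p}} {n a b} → p ∣ n → a ≈[ n ] b → (a ^ p) ≈[ p * n ] (b ^ p)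
^-lift-≈ p@(suc m) {n} {a} {b} (divides k refl) (shift i j eq) =
  ≈-trans (≈-sym (absorb a i)) (≈-trans (≈-reflexive (cong (_^ p) eq)) (absorb b j))
  where
  open Congruence (p * n)
  absorb : ∀ a i → ((a + i * n) ^ p) ≈[ p * n ] (a ^ p)
  absorb a i with binomial-mod-square m a (i * n)
  ... | r , eq = shift 0 (i * a ^ m + i * i * k * r) (trans (ℕ.+-identityʳ _) (trans eq (collect p (a ^ p) (a ^ m) i k r)))
    where
    collect : ∀ p B A i k r → B + p * (i * (k * p)) * A + i * (k * p) * (i * (k * p)) * r ≡
      B + (i * A + i * i * k * r) * (p * (k * p))
    collect = solve-∀

-- Two p-th powers lift the congruence from p to p² and then to p³. So t ^ (p * p) is the
-- Teichmüller representative, modulo p³, of the class of t modulo p.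
teichmüller-≈ : ∀ p .{{_ : NonZero p}} {a b} → a ≈[ p ] b → (a ^ (p * p)) ≈[ p ^ 3 ] (b ^ (p * p))
teichmüller-≈ p {a} {b} a≈b = ≈-trans (≈-reflexive (sym (ℕ.^-*-assoc a p p))) (≈-trans
    (subst (λ n → ((a ^ p) ^ p) ≈[ n ] ((b ^ p) ^ p)) (cong (λ z → p * (p * z)) (sym (ℕ.*-identityʳ p)))
      (^-lift-≈ p (m∣m*n p) (^-lift-≈ p ∣-refl a≈b)))
    (≈-reflexive (ℕ.^-*-assoc b p p)))
  where open Congruence (p ^ 3)

^-distrib-* : ∀ m a b → (a * b) ^ m ≡ a ^ m * b ^ m
^-distrib-* zero    a b = refl
^-distrib-* (suc m) a b = trans (cong (a * b *_) (^-distrib-* m a b)) (interchange a b (a ^ m) (b ^ m))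
  where
  interchange : ∀ a b A B → a * b * (A * B) ≡ a * A * (b * B)
  interchange = solve-∀

-- Groups of order 8p³

module Order8p³ {p} (p-prime : Prime p) (h : ℕ) (p≡1+2h : p ≡ 1 + 2 * h) {v : ℕ} (v≡8p³ : v ≡ 8 * p ^ 3)
  {_∙_ : Op₂ (Fin v)} {ε : Fin v} {_⁻¹ : Op₁ (Fin v)}
  (isAbelianGroup : IsAbelianGroup _≡_ _∙_ ε _⁻¹) where

  open FiniteAbelianGroup isAbelianGroup
  open GroupProperties (AbelianGroup.group abelianGroup) using (x∙y⁻¹≈ε⇒x≈y; identityʳ-unique)
  open IsAbelianGroup isAbelianGroup using (identityʳ; inverseʳ)
  open PrimeModulus p-prime using (fermat; coefficient-⇑; power-of-quadratic)

  private
    instance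
      p≢0 : NonZero p
      p≢0 = prime⇒nonZero p-prime

  -- p ⁴ is the idempotent of ℤ/8p³ that is 1 modulo 8 and 0 modulo p³; the complementary one is 8 * c.
  abstract
    d c : ℕ
    -- (p⁴ - 1) / 8 written out in `h`. The exponent 4 is even, so p⁴ is 1 modulo 8 for odd p, and
    -- at least 3, so p³ divides p⁴.
    d = 2 * h ^ 4 + 4 * h ^ 3 + 3 * h ^ 2 + h
    -- Chosen so that 8c = 1 + 7p⁴, which represents 1 - p⁴ because 8p⁴ vanishes modulo 8p³.
    c = 1 + 7 * d

    p⁴≡1+8d : p ^ 4 ≡ 1 + 8 * d
    p⁴≡1+8d = trans (cong (_^ 4) p≡1+2h) (fourth h)
      where
      fourth : ∀ h → (1 + 2 * h) * ((1 + 2 * h) * ((1 + 2 * h) * ((1 + 2 * h) * 1))) ≡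
        1 + 8 * (2 * (h * (h * (h * (h * 1)))) + 4 * (h * (h * (h * 1))) + 3 * (h * (h * 1)) + h)
      fourth = solve-∀

    8c≡1+7p⁴ : 8 * c ≡ 1 + 7 * p ^ 4
    8c≡1+7p⁴ = trans (expand d) (cong (λ z → 1 + 7 * z) (sym p⁴≡1+8d))
      where
      expand : ∀ d → 8 * (1 + 7 * d) ≡ 1 + 7 * (1 + 8 * d)
      expand = solve-∀

  8p⁴≡pv : 8 * p ^ 4 ≡ p * v
  8p⁴≡pv = trans (regroup (p ^ 3) p) (cong (p *_) (sym v≡8p³))
    where
    regroup : ∀ P p → 8 * (p * P) ≡ p * (8 * P)
    regroup = solve-∀

  8p³•x≡ε : ∀ x → ((8 * p ^ 3) • x) ≡ ε
  8p³•x≡ε x = trans (cong (_• x) (sym v≡8p³)) (order•x≡ε x)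

  •-≈ : ∀ {a b} x → a ≈[ v ] b → (a • x) ≡ (b • x)
  •-≈ {a} {b} x (shift i j eq) = begin
    a • x                ≡⟨ absorb a i ⟨
    (a + i * v) • x      ≡⟨ cong (_• x) eq ⟩
    (b + j * v) • x      ≡⟨ absorb b j ⟩
    b • x                ∎
    where
    open ≡-Reasoning
    absorb : ∀ a i → ((a + i * v) • x) ≡ (a • x)
    absorb a i = trans (•-homo-+ x a (i * v))
      (trans (cong ((a • x) ∙_) (∣⇒•≡ε x (n∣m*n i) (order•x≡ε x))) (identityʳ _))

  p³∣p⁴ : p ^ 3 ∣ p ^ 4
  p³∣p⁴ = n∣m*n p

  p⁴•x≡x : ∀ x → (8 • x) ≡ ε → ((p ^ 4) • x) ≡ x
  p⁴•x≡x x 8x = begin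
    (p ^ 4) • x            ≡⟨ cong (_• x) p⁴≡1+8d ⟩
    (1 + 8 * d) • x        ≡⟨ cong (x ∙_) (∣⇒•≡ε {8} {8 * d} x (m∣m*n d) 8x) ⟩
    x ∙ ε                  ≡⟨ identityʳ x ⟩
    x                      ∎
    where open ≡-Reasoning

  8•? : Decidable (λ x → (8 • x) ≡ ε)
  8•? x = (8 • x) ≟ ε

  p³•? : Decidable (λ x → ((p ^ 3) • x) ≡ ε)
  p³•? x = ((p ^ 3) • x) ≟ ε

  -- The Sylow 2-subgroup N enters as the elements killed by 8, and the Sylow p-subgroup as those
  -- killed by p³; `ν` is N as an element of the group ring.
  ν : Fin v → ℕ
  ν x = 𝟙 (8•? x)

  ∣N∣ ∣P∣ : ℕ
  ∣N∣ = ∑ ν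
  ∣P∣ = ∑ (λ x → 𝟙 (p³•? x))

  ∑-𝟙-≟ : ∀ {n} (a : Fin n) → ∑ (λ x → 𝟙 (a ≟ x)) ≡ 1
  ∑-𝟙-≟ {suc n} Fin.zero    = cong suc (trans (∑-cong {n} (λ x → 𝟙-cong (Fin.zero ≟ Fin.suc x) (no λ ()) (λ ()) ⊥-elim)) (∑-zero n))
  ∑-𝟙-≟ {suc n} (Fin.suc a) = trans
    (∑-cong {n} (λ x → 𝟙-cong (Fin.suc a ≟ Fin.suc x) (a ≟ x) (λ { refl → refl }) (cong Fin.suc))) (∑-𝟙-≟ a)

  -- Every g factors uniquely as a product of a = p ⁴ • g, killed by 8, and g ∙ a ⁻¹, killed by p³.
  ∣N∣*∣P∣≡v : ∣N∣ * ∣P∣ ≡ v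
  ∣N∣*∣P∣≡v = begin
    ∣N∣ * ∣P∣
      ≡⟨ ℕ.*-comm ∣N∣ ∣P∣ ⟩
    ∣P∣ * ∣N∣
      ≡⟨ *-∑ ∣P∣ ν ⟩
    ∑ (λ a → ∣P∣ * ν a)
      ≡⟨ ∑-cong (λ a → trans (ℕ.*-comm ∣P∣ (ν a)) (trans
           (cong (ν a *_) (∑-permute (λ x → 𝟙 (p³•? x)) (translation (a ⁻¹))))
           (*-∑ (ν a) (λ g → 𝟙 (p³•? (g ∙ (a ⁻¹))))))) ⟩
    ∑ (λ a → ∑ (λ g → ν a * 𝟙 (p³•? (g ∙ (a ⁻¹)))))
      ≡⟨ ∑-swap (λ a g → ν a * 𝟙 (p³•? (g ∙ (a ⁻¹)))) ⟩
    ∑ (λ g → ∑ (λ a → ν a * 𝟙 (p³•? (g ∙ (a ⁻¹)))))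
      ≡⟨ ∑-cong (λ g → trans (∑-cong (λ a → trans (𝟙-× (8•? a) (p³•? (g ∙ (a ⁻¹))))
           (𝟙-cong (8•? a ×-dec p³•? (g ∙ (a ⁻¹))) (((p ^ 4) • g) ≟ a) (unique g a) (exists g a)))) (∑-𝟙-≟ ((p ^ 4) • g))) ⟩
    ∑ {v} (λ g → 1)
      ≡⟨ ∑-one v ⟩
    v ∎
    where
    open ≡-Reasoning
    ∑-one : ∀ n → ∑ {n} (λ _ → 1) ≡ n
    ∑-one zero    = refl
    ∑-one (suc n) = cong suc (∑-one n)
    unique : ∀ g a → (8 • a) ≡ ε × ((p ^ 3) • (g ∙ (a ⁻¹))) ≡ ε → ((p ^ 4) • g) ≡ a
    unique g a (8a , p³ga⁻¹) = trans (x∙y⁻¹≈ε⇒x≈y _ _ (begin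
      ((p ^ 4) • g) ∙ (((p ^ 4) • a) ⁻¹)   ≡⟨ cong (((p ^ 4) • g) ∙_) (•-⁻¹ (p ^ 4) a) ⟨
      ((p ^ 4) • g) ∙ ((p ^ 4) • (a ⁻¹))   ≡⟨ •-distrib-∙ g (a ⁻¹) (p ^ 4) ⟨
      (p ^ 4) • (g ∙ (a ⁻¹))               ≡⟨ ∣⇒•≡ε _ p³∣p⁴ p³ga⁻¹ ⟩
      ε                                    ∎)) (p⁴•x≡x a 8a)
    exists : ∀ g a → ((p ^ 4) • g) ≡ a → (8 • a) ≡ ε × ((p ^ 3) • (g ∙ (a ⁻¹))) ≡ ε
    exists g a refl = 8a , (begin
      (p ^ 3) • (g ∙ (a ⁻¹))               ≡⟨ •-distrib-∙ g (a ⁻¹) (p ^ 3) ⟩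
      ((p ^ 3) • g) ∙ ((p ^ 3) • (a ⁻¹))   ≡⟨ cong (((p ^ 3) • g) ∙_) (•-⁻¹ (p ^ 3) a) ⟩
      ((p ^ 3) • g) ∙ (((p ^ 3) • a) ⁻¹)   ≡⟨ cong (λ y → y ∙ (((p ^ 3) • a) ⁻¹)) p³a≡p³g ⟨
      ((p ^ 3) • a) ∙ (((p ^ 3) • a) ⁻¹)   ≡⟨ inverseʳ _ ⟩
      ε                                    ∎)
      where
      8a : (8 • ((p ^ 4) • g)) ≡ ε
      8a = trans (•-assoc g 8 (p ^ 4)) (∣⇒•≡ε g (subst (v ∣_) (sym 8p⁴≡pv) (n∣m*n p)) (order•x≡ε g))
      p³a≡p³g : ((p ^ 3) • ((p ^ 4) • g)) ≡ ((p ^ 3) • g)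
      p³a≡p³g = trans (•-comm (p ^ 3) (p ^ 4) g) (p⁴•x≡x ((p ^ 3) • g) (trans (•-assoc g 8 (p ^ 3)) (8p³•x≡ε g)))

  N-∙ : ∀ x y → (8 • y) ≡ ε → ν (x ∙ (y ⁻¹)) ≡ ν x
  N-∙ x y 8y = 𝟙-cong (8•? (x ∙ (y ⁻¹))) (8•? x) (λ eq → trans (sym shifted) eq) (λ eq → trans shifted eq)
    where
    open ≡-Reasoning
    shifted : (8 • (x ∙ (y ⁻¹))) ≡ (8 • x)
    shifted = begin
      8 • (x ∙ (y ⁻¹))            ≡⟨ •-distrib-∙ x (y ⁻¹) 8 ⟩
      (8 • x) ∙ (8 • (y ⁻¹))      ≡⟨ cong ((8 • x) ∙_) (trans (•-⁻¹ 8 y) (cong _⁻¹ 8y)) ⟩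
      (8 • x) ∙ (ε ⁻¹)            ≡⟨ cong (_∙ (ε ⁻¹)) (identityʳ (8 • x)) ⟨
      ((8 • x) ∙ ε) ∙ (ε ⁻¹)      ≡⟨ x∙y∙y⁻¹≡x (8 • x) ε ⟩
      8 • x                       ∎

  p∤8 : ¬ p ∣ 8
  p∤8 = prime∤^ p-prime p∤2 3
    where
    p∤2 : ¬ p ∣ 2
    p∤2 p∣2 = prime∤1 p-prime (∣m+n∣m⇒∣n (subst (p ∣_) (trans p≡1+2h (ℕ.+-comm 1 _)) ∣-refl) (∣-trans p∣2 (m∣m*n h)))

  -- If p divided ∣N∣ then ν, whose square is ∣N∣ ν, would be nilpotent modulo p,
  -- but its p-th power has coefficient 1 at ε.
  p∤∣N∣ : ¬ p ∣ ∣N∣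
  p∤∣N∣ p∣∣N∣ = prime∤1 p-prime (≈0⇒∣ (≈-trans (≈-sym one) (zero-coefficient p refl)))
    where
    open Congruence p
    open GroupRing modSemiring isAbelianGroup using (_✶_; _⇑_)
    ν-nonzero : ∀ g → ν g ≢ 0 → (8 • g) ≡ ε
    ν-nonzero g ν≢0 with 8•? g
    ... | yes eq = eq
    ... | no _   = contradiction refl ν≢0
    νε≡1 : ν ε ≡ 1
    νε≡1 = 𝟙-cong (8•? ε) (yes refl) (λ _ → refl {x = 0}) (λ _ → •-ε 8)
    one : (ν ⇑ p) (p • ε) ≈[ p ] 1
    one = ≈-trans (coefficient-⇑ isAbelianGroup ν ε (λ g eq νg≢0 → sym (coprime-•≡ε g
        (∤prime⇒coprime p-prime p∤8) (ν-nonzero g νg≢0) (trans eq (•-ε p)))))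
      (≈-reflexive νε≡1)
    ν² : ∀ x → (ν ✶ ν) x ≡ ∣N∣ * ν x + 0
    ν² x = trans (∑-cong term) (trans (sym (*-∑ (ν x) ν)) (trans (ℕ.*-comm (ν x) ∣N∣) (sym (ℕ.+-identityʳ _))))
      where
      term : ∀ y → ν (x ∙ (y ⁻¹)) * ν y ≡ ν x * ν y
      term y with 8•? y
      ... | yes 8y = cong (_* 1) (N-∙ x y 8y)
      ... | no _   = trans (ℕ.*-zeroʳ (ν (x ∙ (y ⁻¹)))) (sym (ℕ.*-zeroʳ (ν x)))
    zero-coefficient : ∀ n → n ≡ p → (ν ⇑ n) (p • ε) ≈[ p ] 0
    zero-coefficient zero          n≡p = contradiction (subst NonZero (sym n≡p) p≢0) λ ()
    zero-coefficient (suc zero)    n≡p = contradiction (∣-reflexive (sym n≡p)) (prime∤1 p-prime)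
    -- The power ν ^ (m + 2) carries ∣N∣ ^ (m + 1), hence at least one factor `∣N∣`; this is why the
    -- exponents 0 and 1 are split off.
    zero-coefficient (suc (suc m)) n≡p with power-of-quadratic isAbelianGroup ν ∣N∣ 0 ν² (suc m)
    ... | _ , νᵐ = ≈-trans (νᵐ (p • ε)) (∣⇒≈0 (subst (p ∣_) (sym (ℕ.+-identityʳ _)) (∣m⇒∣m*n _ (∣m⇒∣m*n _ p∣∣N∣))))

  -- `∣N∣` divides 8 p³ and is coprime to p³, so it divides 8.
  ∣N∣≤8 : ∣N∣ ≤ 8
  ∣N∣≤8 = ∣⇒≤ (coprime-divisor (coprime-^ (∤prime⇒coprime p-prime p∤∣N∣) 3)
    (divides ∣P∣ (trans (ℕ.*-comm (p ^ 3) 8) (trans (sym v≡8p³) (trans (sym ∣N∣*∣P∣≡v) (ℕ.*-comm ∣N∣ ∣P∣))))))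

  -- The action of the Teichmüller representatives

  s : ℕ → ℕ
  -- The Chinese remainder theorem in terms of the two idempotents: `s t` is 1 modulo 8 and t ^ (p *
  -- p) modulo p³.
  s t = p ^ 4 + 8 * c * t ^ (p * p)

  σ : ℕ → Fin v → Fin v
  σ t x = s t • x

  σ-cong : ∀ {t u} x → t ≈[ p ] u → σ t x ≡ σ u x
  σ-cong {t} {u} x t≈u with teichmüller-≈ p t≈u
  ... | shift i j eq = •-≈ x (shift (c * i) (c * j) (begin
    p ^ 4 + 8 * c * T + c * i * v            ≡⟨ cong (λ z → p ^ 4 + 8 * c * T + c * i * z) v≡8p³ ⟩
    p ^ 4 + 8 * c * T + c * i * (8 * p ^ 3)  ≡⟨ factor (p ^ 4) c T i (p ^ 3) ⟩
    p ^ 4 + 8 * c * (T + i * p ^ 3)          ≡⟨ cong (λ z → p ^ 4 + 8 * c * z) eq ⟩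
    p ^ 4 + 8 * c * (U + j * p ^ 3)          ≡⟨ factor (p ^ 4) c U j (p ^ 3) ⟨
    p ^ 4 + 8 * c * U + c * j * (8 * p ^ 3)  ≡⟨ cong (λ z → p ^ 4 + 8 * c * U + c * j * z) v≡8p³ ⟨
    p ^ 4 + 8 * c * U + c * j * v            ∎))
    where
    open ≡-Reasoning
    T = t ^ (p * p)
    U = u ^ (p * p)
    factor : ∀ Q c T i P → Q + 8 * c * T + c * i * (8 * P) ≡ Q + 8 * c * (T + i * P)
    factor = solve-∀

  σ-1 : ∀ x → σ 1 x ≡ x
  σ-1 x = trans (•-≈ x (shift 0 p (begin
    p ^ 4 + 8 * c * 1 ^ (p * p) + 0    ≡⟨ cong₂ (λ a b → p ^ 4 + a * b + 0) 8c≡1+7p⁴ (ℕ.^-zeroˡ (p * p)) ⟩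
    p ^ 4 + (1 + 7 * p ^ 4) * 1 + 0    ≡⟨ collect (p ^ 4) ⟩
    1 + 8 * p ^ 4                      ≡⟨ cong (λ z → 1 + z) 8p⁴≡pv ⟩
    1 + p * v                          ∎))) (•-identity x)
    where
    open ≡-Reasoning
    collect : ∀ Q → Q + (1 + 7 * Q) * 1 + 0 ≡ 1 + 8 * Q
    collect = solve-∀

  σ-∘ : ∀ t u x → σ t (σ u x) ≡ σ (t * u) x
  σ-∘ t u x = trans (•-assoc x (s t) (s u)) (•-≈ x (shift 0 (p * k) (begin
    s t * s u + 0
      ≡⟨ expand Q (8 * c) T U ⟩
    Q * Q + 8 * c * Q * (T + U) + 8 * c * (8 * c) * (T * U)
      ≡⟨ cong₂ (λ a b → Q * a + 8 * c * Q * (T + U) + 8 * c * b * (T * U)) p⁴≡1+8d 8c≡1+7p⁴ ⟩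
    Q * (1 + 8 * d) + 8 * c * Q * (T + U) + 8 * c * (1 + 7 * Q) * (T * U)
      ≡⟨ collect Q c d T U ⟩
    Q + 8 * c * (T * U) + k * (8 * Q)
      ≡⟨ cong₂ (λ a b → Q + 8 * c * a + k * b) (sym (^-distrib-* (p * p) t u)) 8p⁴≡pv ⟩
    s (t * u) + k * (p * v)
      ≡⟨ cong (λ z → s (t * u) + z) (trans (sym (ℕ.*-assoc k p v)) (cong (_* v) (ℕ.*-comm k p))) ⟩
    s (t * u) + p * k * v ∎)))
    where
    open ≡-Reasoning
    Q = p ^ 4
    T = t ^ (p * p)
    U = u ^ (p * p)
    -- As natural numbers, p⁴ and 8c are orthogonal idempotents only up to multiples of 8p⁴; `k`
    -- collects these multiples.
    k = d + c * (T + U) + 7 * c * (T * U)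
    expand : ∀ Q C T U → (Q + C * T) * (Q + C * U) + 0 ≡ Q * Q + C * Q * (T + U) + C * C * (T * U)
    expand = solve-∀
    collect : ∀ Q c d T U → Q * (1 + 8 * d) + 8 * c * Q * (T + U) + 8 * c * (1 + 7 * Q) * (T * U) ≡
      Q + 8 * c * (T * U) + (d + c * (T + U) + 7 * c * (T * U)) * (8 * Q)
    collect = solve-∀

  σ-fixes-N : ∀ t {x} → (8 • x) ≡ ε → σ t x ≡ x
  σ-fixes-N t {x} 8x = begin
    (p ^ 4 + 8 * c * T) • x               ≡⟨ •-homo-+ x (p ^ 4) (8 * c * T) ⟩
    ((p ^ 4) • x) ∙ ((8 * c * T) • x)     ≡⟨ cong₂ _∙_ (p⁴•x≡x x 8x) (∣⇒•≡ε {8} {8 * c * T} x (∣m⇒∣m*n T (m∣m*n c)) 8x) ⟩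
    x ∙ ε                                 ≡⟨ identityʳ x ⟩
    x                                     ∎
    where
    open ≡-Reasoning
    T = t ^ (p * p)

  p∤c : ¬ p ∣ c
  p∤c p∣c = prime∤1 p-prime (∣m+n∣m⇒∣n (subst (p ∣_) (trans 8c≡1+7p⁴ (ℕ.+-comm 1 _)) (∣n⇒∣m*n 8 p∣c))
    (∣n⇒∣m*n 7 (m∣m*n (p ^ 3))))

  t^p²≈t : ∀ t → (t ^ (p * p)) ≈[ p ] t
  t^p²≈t t = ≈-trans (≈-reflexive (sym (ℕ.^-*-assoc t p p))) (≈-trans (fermat (t ^ p)) (fermat t))
    where open Congruence p

  -- The exponents differ by 8 c e with e ≡ u - t modulo p, by Fermat. So c e is prime to p and
  -- kills 8 • x, which p³ kills as well.
  σ-free-< : ∀ {t u} x → t < u → u < p → σ t x ≡ σ u x → (8 • x) ≡ ε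
  σ-free-< {t} {u} x t<u u<p eq = coprime-•≡ε (8 • x)
    (coprime-^ (∤prime⇒coprime p-prime p∤ce) 3) ce•8x p³•8x
    where
    open ≡-Reasoning
    T = t ^ (p * p)
    e = u ^ (p * p) ∸ T
    T+e≡U : T + e ≡ u ^ (p * p)
    T+e≡U = ℕ.m+[n∸m]≡n (ℕ.^-monoˡ-≤ (p * p) (<⇒≤ t<u))
    p∤e : ¬ p ∣ e
    p∤e p∣e = >⇒∤ {{N.>-nonZero (ℕ.m<n⇒0<n∸m t<u)}} (ℕ.≤-<-trans (ℕ.m∸n≤m u t) u<p) (≈0⇒∣ (+-cancelˡ-≈ t
      (≈-trans (≈-reflexive (ℕ.m+[n∸m]≡n (<⇒≤ t<u))) (≈-trans (≈-sym (t^p²≈t u)) (≈-trans (≈-reflexive (sym T+e≡U))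
        (+-cong-≈ (t^p²≈t t) (∣⇒≈0 p∣e)))))))
      where open Congruence p
    p∤ce : ¬ p ∣ c * e
    p∤ce p∣ce = [ p∤c , p∤e ]′ (euclidsLemma c e p-prime p∣ce)
    s-u : s u ≡ s t + (c * e) * 8
    s-u = trans (cong (λ z → p ^ 4 + 8 * c * z) (sym T+e≡U)) (spread (p ^ 4) c T e)
      where
      spread : ∀ Q c T e → Q + 8 * c * (T + e) ≡ Q + 8 * c * T + (c * e) * 8
      spread = solve-∀
    ce•8x : ((c * e) • (8 • x)) ≡ ε
    ce•8x = trans (•-assoc x (c * e) 8) (identityʳ-unique (σ t x) _ (begin
      σ t x ∙ ((c * e * 8) • x)     ≡⟨ •-homo-+ x (s t) (c * e * 8) ⟨
      (s t + c * e * 8) • x         ≡⟨ cong (_• x) s-u ⟨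
      σ u x                         ≡⟨ eq ⟨
      σ t x                         ∎))
    p³•8x : ((p ^ 3) • (8 • x)) ≡ ε
    p³•8x = trans (•-assoc x (p ^ 3) 8) (trans (cong (_• x) (ℕ.*-comm (p ^ 3) 8)) (8p³•x≡ε x))

  σ-free : ∀ {t u} x → t < p → u < p → σ t x ≡ σ u x → (8 • x) ≢ ε → t ≡ u
  σ-free {t} {u} x t<p u<p eq 8x≢ε with ℕ.<-cmp t u
  ... | tri< t<u _ _ = contradiction (σ-free-< x t<u u<p eq) 8x≢ε
  ... | tri≈ _ t≡u _ = t≡u
  ... | tri> _ _ u<t = contradiction (σ-free-< x u<t t<p (sym eq)) 8x≢ε

  r : ℕ
  r = p ∸ 1

  p≡1+r : p ≡ suc r
  p≡1+r = sym (ℕ.suc-pred p)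

  -- The list always has p - 1 entries: on N they all coincide, off N they are distinct.
  orbit : Fin v → List (Fin v)
  orbit x = map (λ i → σ (suc (toℕ i)) x) (allFin r)

  σ∈orbit : ∀ t x → ¬ p ∣ t → σ t x ∈ₗ orbit x
  σ∈orbit t x p∤t with t % p in t%p≡ | m%n<n t p
  ... | zero  | _    = contradiction (m%n≡0⇒n∣m t p t%p≡) p∤t
  ... | suc w | w<p = subst (_∈ₗ orbit x) σ-w (∈-map⁺ (λ i → σ (suc (toℕ i)) x) (∈-allFin (fromℕ< w<r)))
    where
    w<r : w < r
    w<r = N.s<s⁻¹ (subst (suc w <_) p≡1+r w<p)
    σ-w : σ (suc (toℕ (fromℕ< w<r))) x ≡ σ t x
    σ-w = σ-cong x (shift (t / p) 0 (trans (cong (λ z → z + t / p * p) (trans (cong suc (toℕ-fromℕ< w<r)) (sym t%p≡)))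
      (trans (sym (m≡m%n+[m/n]*n t p)) (sym (ℕ.+-identityʳ t)))))

  orbit∈σ : ∀ {x y} → y ∈ₗ orbit x → ∃[ t ] ¬ p ∣ t × y ≡ σ t x
  orbit∈σ {x} y∈ with ∈-map⁻ (λ i → σ (suc (toℕ i)) x) y∈
  ... | i , _ , eq = suc (toℕ i) , >⇒∤ (subst (suc (toℕ i) <_) (sym p≡1+r) (s<s (toℕ<n i))) , eq

  -- The exponent is p - 2. Fermat gives p ∣ t * (t ^ (p - 1) - 1), and p does not divide t.
  inverse-mod-p : ∀ t → ¬ p ∣ t → (t ^ (r ∸ 1) * t) ≈[ p ] 1
  inverse-mod-p t p∤t = ≈-sym (≈-trans (≈-sym (+-cong-≈ (≈-refl {1}) (∣⇒≈0 p∣e))) (≈-reflexive 1+e≡))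
    where
    open Congruence p
    a = t ^ (r ∸ 1) * t
    2≤p : 2 ≤ p
    2≤p = N.nonTrivial⇒n>1 p {{prime⇒nonTrivial p-prime}}
    r≡ : suc (r ∸ 1) ≡ r
    r≡ = ℕ.m+[n∸m]≡n (ℕ.∸-monoˡ-≤ 1 2≤p)
    ta≡t^p : t * a ≡ t ^ p
    ta≡t^p = trans (cong (t *_) (ℕ.*-comm (t ^ (r ∸ 1)) t)) (cong (t ^_) (trans (cong suc r≡) (sym p≡1+r)))
    e = a ∸ 1
    a≢0 : a ≢ 0
    a≢0 a≡0 = [ prime∤^ p-prime p∤t (r ∸ 1) , p∤t ]′ (euclidsLemma (t ^ (r ∸ 1)) t p-prime (subst (p ∣_) (sym a≡0) (p ∣0)))
    1+e≡ : 1 + e ≡ a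
    1+e≡ = ℕ.m+[n∸m]≡n (ℕ.n≢0⇒n>0 a≢0)
    p∣te : p ∣ t * e
    p∣te = ≈0⇒∣ (+-cancelˡ-≈ t (≈-trans (≈-reflexive (trans (sym (ℕ.*-suc t e)) (trans (cong (t *_) 1+e≡) ta≡t^p)))
      (≈-trans (fermat t) (≈-reflexive (sym (ℕ.+-identityʳ t))))))
    p∣e : p ∣ e
    p∣e = [ (λ p∣t → contradiction p∣t p∤t) , id ]′ (euclidsLemma t e p-prime p∣te)

  orbit-refl : ∀ x → x ∈ₗ orbit x
  orbit-refl x = subst (_∈ₗ orbit x) (σ-1 x) (σ∈orbit 1 x (prime∤1 p-prime))

  orbit-sym : ∀ {x y} → y ∈ₗ orbit x → x ∈ₗ orbit y
  orbit-sym {x} y∈ with orbit∈σ y∈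
  ... | t , p∤t , refl = subst (_∈ₗ orbit (σ t x))
    (trans (σ-∘ (t ^ (r ∸ 1)) t x) (trans (σ-cong x (inverse-mod-p t p∤t)) (σ-1 x)))
    (σ∈orbit (t ^ (r ∸ 1)) (σ t x) (prime∤^ p-prime p∤t (r ∸ 1)))

  orbit-trans : ∀ {x y z} → y ∈ₗ orbit x → z ∈ₗ orbit y → z ∈ₗ orbit x
  orbit-trans {x} y∈ z∈ with orbit∈σ y∈ | orbit∈σ z∈
  ... | t , p∤t , refl | u , p∤u , refl = subst (_∈ₗ orbit x) (sym (σ-∘ u t x))
    (σ∈orbit (u * t) x (λ p∣ → [ p∤u , p∤t ]′ (euclidsLemma u t p-prime p∣)))

  -- Off N the set P is a union of full orbits. It is applied to `D` and to the representations of a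
  -- fixed element of D ∩ N.
  p-1∣count : ∀ {P : Fin v → Set} (P? : Decidable P) → (∀ {t x} → ¬ p ∣ t → P x → P (σ t x)) →
    r ∣ ∑ (λ x → 𝟙 (P? x ×-dec ¬? (8•? x)))
  p-1∣count {P} P? closed = subst (r ∣_) (sym (∑-𝟙 Q?))
    (orbit-size∣length orbit orbit-refl orbit-sym orbit-trans (filter Q? (allFin v)) (filter-unique Q? (allFin-unique v))
      (λ x∈ → let _ , 8x≢ε = member x∈ in
        map-unique (λ {i} {j} eq → toℕ-injective (ℕ.suc-injective (σ-free _ (index i) (index j) eq 8x≢ε))) (allFin-unique r)
        , trans (length-map _ (allFin r)) (length-tabulate id))
      (λ {x} x∈ y∈ → step x∈ (orbit∈σ y∈)))
    where
    Q? : Decidable (λ x → P x × (8 • x) ≢ ε)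
    Q? x = P? x ×-dec ¬? (8•? x)
    member : ∀ {x} → x ∈ₗ filter Q? (allFin v) → P x × (8 • x) ≢ ε
    member x∈ = proj₂ (∈-filter⁻ Q? {xs = allFin v} x∈)
    index : ∀ i → suc (toℕ {r} i) < p
    index i = subst (suc (toℕ i) <_) (sym p≡1+r) (s<s (toℕ<n i))
    step : ∀ {x y} → x ∈ₗ filter Q? (allFin v) → (∃[ t ] ¬ p ∣ t × y ≡ σ t x) → y ∈ₗ filter Q? (allFin v)
    -- The orbit of x stays outside N: an image in N would be fixed by the map leading back to x, so
    -- x itself would lie in N.
    step {x} x∈ (t , p∤t , refl) with member x∈ | orbit∈σ (orbit-sym (σ∈orbit t x p∤t))
    ... | Px , 8x≢ε | u , _ , x≡ = ∈-filter⁺ Q? (∈-allFin (σ t x)) (closed p∤t Px ,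
      λ 8y≡ε → 8x≢ε (trans (cong (8 •_) (trans x≡ (σ-fixes-N u 8y≡ε))) 8y≡ε))

-- Regular partial difference sets in groups of order 8p³

∑-𝟙≢0 : ∀ {n} {P : Fin n → Set} (P? : Decidable P) → ∑ (λ i → 𝟙 (P? i)) ≢ 0 → ∃ P
∑-𝟙≢0 {zero}  P? ≢0 = contradiction refl ≢0
∑-𝟙≢0 {suc n} P? ≢0 with P? Fin.zero
... | yes p0 = Fin.zero , p0
... | no _ with ∑-𝟙≢0 (P? ∘ Fin.suc) ≢0
... | i , pi = Fin.suc i , pi

𝟙-yes : ∀ {A : Set} (A? : Dec A) → A → 𝟙 A? ≡ 1
𝟙-yes A? a = 𝟙-cong A? (yes a) id id

𝟙-no : ∀ {A : Set} (A? : Dec A) → ¬ A → 𝟙 A? ≡ 0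
𝟙-no A? ¬a = 𝟙-cong A? (no ¬a) id id

-- The two equations for `t` compare the coefficients of E² and 4p E + μ G on D and at the identity.
-- On the remaining elements both coefficients are μ.
module RegularPDS {p} (p-prime : Prime p) (h : ℕ) (p≡1+2h : p ≡ 1 + 2 * h) {v : ℕ} (v≡8p³ : v ≡ 8 * p ^ 3)
  {_∙_ : Op₂ (Fin v)} {ε : Fin v} {_⁻¹ : Op₁ (Fin v)}
  (isAbelianGroup : IsAbelianGroup _≡_ _∙_ ε _⁻¹)
  {D : Subset v} {k lam μ : ℕ} (pds : PDSDefs.IsPDS _∙_ ε _⁻¹ D k lam μ) (regular : PDSDefs.IsRegular _∙_ ε _⁻¹ D)
  (t : ℕ) (lam+2t≡ : lam + 2 * t ≡ 4 * p + μ) (k+t²≡ : k + t * t ≡ 4 * p * t + μ) where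

  open FiniteAbelianGroup isAbelianGroup
  open GroupProperties (AbelianGroup.group abelianGroup) using (⁻¹-involutive; ⁻¹-injective; x∙y⁻¹≈ε⇒x≈y)
  open IsAbelianGroup isAbelianGroup using (identityˡ; inverseʳ)
  open Order8p³ p-prime h p≡1+2h v≡8p³ isAbelianGroup
  open PDSDefs _∙_ ε _⁻¹ using (rep)
  open GroupRing ℕ.+-*-commutativeSemiring isAbelianGroup using (sum-δ; x∙ε⁻¹≡x)
  open ≡-Reasoning

  D-⁻¹ : ∀ x → x ∈ D → (x ⁻¹) ∈ D
  D-⁻¹ = proj₁ regular

  ε∉D : ε ∉ D
  ε∉D = proj₂ (proj₂ regular)

  χ : Fin v → ℕ
  χ x = 𝟙 (x ∈? D)

  Pair? : ∀ x → Decidable (λ g → (x ∙ (g ⁻¹)) ∈ D × g ∈ D)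
  Pair? x g = ((x ∙ (g ⁻¹)) ∈? D) ×-dec (g ∈? D)

  autocorrelation : Fin v → ℕ
  autocorrelation x = ∑ (λ g → χ (x ∙ (g ⁻¹)) * χ g)

  autocorrelation-count : ∀ x → autocorrelation x ≡ ∑ (λ g → 𝟙 (Pair? x g))
  autocorrelation-count x = ∑-cong (λ g → 𝟙-× ((x ∙ (g ⁻¹)) ∈? D) (g ∈? D))

  autocorrelation-ε : autocorrelation ε ≡ k
  autocorrelation-ε = trans (∑-cong term) (trans (∑-𝟙-∈ D) (proj₁ pds))
    where
    term : ∀ g → χ (ε ∙ (g ⁻¹)) * χ g ≡ χ g
    term g = trans (𝟙-× ((ε ∙ (g ⁻¹)) ∈? D) (g ∈? D)) (𝟙-cong (Pair? ε g) (g ∈? D) proj₂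
      (λ g∈ → subst (_∈ D) (sym (identityˡ _)) (D-⁻¹ g g∈) , g∈))

  -- Because D is closed under inversion, g ↦ (x g⁻¹, g⁻¹) turns factorisations of x in D into
  -- quotients; the two components differ because x is not the identity.
  autocorrelation-rep : ∀ x → x ≢ ε → autocorrelation x ≡ rep D x
  autocorrelation-rep x x≢ε = trans (autocorrelation-count x) (trans (∑-𝟙 (Pair? x)) (count _))
    where
    Q : Fin v × Fin v → Set
    Q (g , g′) = (g ∈ D × g′ ∈ D) × (g ≢ g′ × (g ∙ (g′ ⁻¹)) ≡ x)
    pair : Fin v → Fin v × Fin v
    pair g = (x ∙ (g ⁻¹)) , (g ⁻¹)
    pairs = map pair (filter (Pair? x) (allFin v))
    all-pairs = cartesianProduct (allFin v) (allFin v)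
    to : (Q? : Decidable Q) → ∀ {z} → z ∈ₗ pairs → z ∈ₗ filter Q? all-pairs
    to Q? z∈ with ∈-map⁻ pair z∈
    ... | g , g∈ , refl with proj₂ (∈-filter⁻ (Pair? x) {xs = allFin v} g∈)
    ... | xg⁻¹∈D , g∈D = ∈-filter⁺ Q? (∈-cartesianProduct⁺ (∈-allFin _) (∈-allFin _))
      ((xg⁻¹∈D , D-⁻¹ g g∈D) ,
       (λ eq → x≢ε (trans (sym difference) (trans (cong (λ y → y ∙ ((g ⁻¹) ⁻¹)) eq) (inverseʳ _)))) , difference)
      where
      difference : ((x ∙ (g ⁻¹)) ∙ ((g ⁻¹) ⁻¹)) ≡ x
      difference = x∙y∙y⁻¹≡x x (g ⁻¹)
    from : (Q? : Decidable Q) → ∀ {z} → z ∈ₗ filter Q? all-pairs → z ∈ₗ pairs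
    from Q? {a , b} z∈ with proj₂ (∈-filter⁻ Q? {xs = all-pairs} z∈)
    ... | (a∈D , b∈D) , (_ , ab⁻¹≡x) = subst (_∈ₗ pairs) (cong₂ _,_ xb≡a (⁻¹-involutive b))
      (∈-map⁺ pair (∈-filter⁺ (Pair? x) (∈-allFin (b ⁻¹)) (subst (_∈ D) (sym xb≡a) a∈D , D-⁻¹ b b∈D)))
      where
      xb≡a : (x ∙ ((b ⁻¹) ⁻¹)) ≡ a
      xb≡a = trans (cong₂ _∙_ (sym ab⁻¹≡x) (⁻¹-involutive b)) (x∙y⁻¹∙y≡x a b)
    -- The decision procedure used by `rep` is local to it, so the count is made for an arbitrary
    -- one.
    count : (Q? : Decidable Q) → length (filter (Pair? x) (allFin v)) ≡ length (filter Q? all-pairs)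
    count Q? = trans (sym (length-map pair (filter (Pair? x) (allFin v)))) (length-unique
      (map-unique (λ eq → ⁻¹-injective (cong proj₂ eq)) (filter-unique (Pair? x) (allFin-unique v)))
      (filter-unique Q? (cartesianProduct-unique (allFin-unique v) (allFin-unique v))) (to Q?) (from Q?))

  ∑-* : ∀ (f : Fin v → ℕ) a → ∑ (λ g → 𝟙 (a ≟ g) * f g) ≡ f a
  ∑-* f a = sum-δ f a (λ g → 𝟙 (a ≟ g)) (𝟙-yes (a ≟ a) refl) (λ g a≢g → 𝟙-no (a ≟ g) a≢g)

  -- The shifted element E and the multipliers of D

  E : Fin v → ℕ
  E x = χ x + t * 𝟙 (ε ≟ x)

  E-ε : E ε ≡ t
  E-ε = trans (cong₂ (λ a b → a + t * b) (𝟙-no (ε ∈? D) ε∉D) (𝟙-yes (ε ≟ ε) refl)) (ℕ.*-identityʳ t)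

  E-≢ε : ∀ {x} → x ≢ ε → E x ≡ χ x
  E-≢ε {x} x≢ε = trans (cong (λ a → χ x + t * a) (𝟙-no (ε ≟ x) (x≢ε ∘ sym)))
    (trans (cong (λ a → χ x + a) (ℕ.*-zeroʳ t)) (ℕ.+-identityʳ _))

  E✶E : ∀ x → ∑ (λ g → E (x ∙ (g ⁻¹)) * E g) ≡ autocorrelation x + t * χ x + t * E x
  E✶E x = begin
    ∑ (λ g → E (x ∙ (g ⁻¹)) * E g)
      ≡⟨ ∑-cong (λ g → expand (χ (x ∙ (g ⁻¹))) (χ g) (𝟙 (ε ≟ (x ∙ (g ⁻¹)))) (𝟙 (ε ≟ g)) t) ⟩
    ∑ (λ g → A g + t * (𝟙 (ε ≟ (x ∙ (g ⁻¹))) * χ g) + t * C g)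
      ≡⟨ ∑-cong (λ g → cong (λ a → A g + t * (a * χ g) + t * C g) (𝟙-cong (ε ≟ (x ∙ (g ⁻¹))) (x ≟ g)
           (λ eq → x∙y⁻¹≈ε⇒x≈y x g (sym eq)) (λ { refl → sym (inverseʳ x) }))) ⟩
    ∑ (λ g → A g + t * B g + t * C g)
      ≡⟨ ∑-+ (λ g → A g + t * B g) (λ g → t * C g) ⟩
    ∑ (λ g → A g + t * B g) + ∑ (λ g → t * C g)
      ≡⟨ cong₂ _+_ (∑-+ A (λ g → t * B g)) (sym (*-∑ t C)) ⟩
    ∑ A + ∑ (λ g → t * B g) + t * ∑ C
      ≡⟨ cong (λ a → ∑ A + a + t * ∑ C) (sym (*-∑ t B)) ⟩
    ∑ A + t * ∑ B + t * ∑ C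
      ≡⟨ cong₂ (λ a b → ∑ A + t * a + t * b) (∑-* χ x) (trans (∑-* (λ g → E (x ∙ (g ⁻¹))) ε) (cong E (x∙ε⁻¹≡x x))) ⟩
    autocorrelation x + t * χ x + t * E x ∎
    where
    A B C : Fin v → ℕ
    A g = χ (x ∙ (g ⁻¹)) * χ g
    B g = 𝟙 (x ≟ g) * χ g
    C g = 𝟙 (ε ≟ g) * E (x ∙ (g ⁻¹))
    expand : ∀ a b i j t → (a + t * i) * (b + t * j) ≡ a * b + t * (i * b) + t * (j * (a + t * i))
    expand = solve-∀

  E-quadratic : ∀ x → ∑ (λ g → E (x ∙ (g ⁻¹)) * E g) ≡ 4 * p * E x + μ
  E-quadratic x = trans (E✶E x) (cases (x ≟ ε) (x ∈? D))
    where
    evaluate : ∀ {a b c} → autocorrelation x ≡ a → χ x ≡ b → E x ≡ c →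
      a + t * b + t * c ≡ 4 * p * c + μ → autocorrelation x + t * χ x + t * E x ≡ 4 * p * E x + μ
    evaluate refl refl refl eq = eq
    cases : Dec (x ≡ ε) → Dec (x ∈ D) → autocorrelation x + t * χ x + t * E x ≡ 4 * p * E x + μ
    cases (yes refl) _ = evaluate autocorrelation-ε (𝟙-no (ε ∈? D) ε∉D) E-ε
      (trans (cong (λ z → z + t * t) (trans (cong (λ z → k + z) (ℕ.*-zeroʳ t)) (ℕ.+-identityʳ k))) k+t²≡)
    cases (no x≢ε) (yes x∈D) = evaluate (trans (autocorrelation-rep x x≢ε) (proj₁ (proj₂ pds x x≢ε) x∈D)) χx≡1
      (trans (E-≢ε x≢ε) χx≡1) (trans (double lam t) (trans lam+2t≡ (cong (λ z → z + μ) (sym (ℕ.*-identityʳ (4 * p))))))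
      where
      χx≡1 = 𝟙-yes (x ∈? D) x∈D
      double : ∀ l t → l + t * 1 + t * 1 ≡ l + 2 * t
      double = solve-∀
    cases (no x≢ε) (no x∉D) = evaluate (trans (autocorrelation-rep x x≢ε) (proj₂ (proj₂ pds x x≢ε) x∉D)) χx≡0
      (trans (E-≢ε x≢ε) χx≡0) (vanish μ t p)
      where
      χx≡0 = 𝟙-no (x ∈? D) x∉D
      vanish : ∀ μ t p → μ + t * 0 + t * 0 ≡ 4 * p * 0 + μ
      vanish = solve-∀

  -- Neither x nor its q-th power is the identity, so E agrees with `χ` at both. If the power left
  -- D, the congruence 4p E(x) ≡ 4p E(q • x) would read 4p ≡ 0 modulo q.
  prime-multiplier : ∀ {q} → Prime q → ¬ q ∣ 2 → ¬ q ∣ p → ∀ {x} → x ∈ D → (q • x) ∈ D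
  prime-multiplier {q} q-prime q∤2 q∤p {x} x∈D with (q • x) ∈? D
  ... | yes qx∈D = qx∈D
  ... | no qx∉D  = contradiction q∣4p λ q∣ → [ prime∤^ q-prime q∤2 2 , q∤p ]′ (euclidsLemma 4 p q-prime q∣)
    where
    open Congruence q
    q⊥v : Coprime q v
    q⊥v = subst (Coprime q) (sym v≡8p³) (coprime-*
      (coprime-^ {a = 2} (Coprimality.sym (∤prime⇒coprime q-prime q∤2)) 3)
      (coprime-^ (Coprimality.sym (∤prime⇒coprime q-prime q∤p)) 3))
    x≢ε : x ≢ ε
    x≢ε refl = ε∉D x∈D
    qx≢ε : (q • x) ≢ ε
    qx≢ε eq = x≢ε (•-injective q⊥v (trans eq (sym (•-ε q))))
    q∣4p : q ∣ 4 * p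
    q∣4p = ≈0⇒∣ (≈-trans (≈-reflexive (sym (trans (cong (4 * p *_) (trans (E-≢ε x≢ε) (𝟙-yes (x ∈? D) x∈D))) (ℕ.*-identityʳ (4 * p)))))
      (≈-trans (PrimeModulus.quadratic-multiplier q-prime isAbelianGroup q⊥v E (4 * p) μ E-quadratic x)
        (≈-reflexive (trans (cong (4 * p *_) (trans (E-≢ε qx≢ε) (𝟙-no ((q • x) ∈? D) qx∉D))) (ℕ.*-zeroʳ (4 * p))))))

  multiplier : ∀ s .{{_ : NonZero s}} → ¬ 2 ∣ s → ¬ p ∣ s → ∀ {x} → x ∈ D → (s • x) ∈ D
  multiplier s 2∤s p∤s {x} x∈D = subst (λ n → (n • x) ∈ D) (sym isFactorisation)
    (go factors factorsPrime (subst (λ n → ¬ 2 ∣ n) isFactorisation 2∤s) (subst (λ n → ¬ p ∣ n) isFactorisation p∤s))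
    where
    open PrimeFactorisation (factorise s)
    ∤-prime : ∀ {q} n → Prime q → Prime n → ¬ n ∣ q → ¬ q ∣ n
    ∤-prime n q-prime n-prime n∤q q∣n with prime⇒irreducible n-prime q∣n
    ... | inj₁ refl = prime∤1 q-prime ∣-refl
    ... | inj₂ refl = n∤q ∣-refl
    go : ∀ qs → All Prime qs → ¬ 2 ∣ product qs → ¬ p ∣ product qs → (product qs • x) ∈ D
    go []       _ _ _ = subst (_∈ D) (sym (•-identity x)) x∈D
    go (q ∷ qs) (q-prime ∷ qs-prime) 2∤ p∤ = subst (_∈ D) (•-assoc x q (product qs))
      (prime-multiplier q-prime
        (∤-prime 2 q-prime prime[2] (λ 2∣q → 2∤ (∣m⇒∣m*n (product qs) 2∣q)))
        (∤-prime p q-prime p-prime (λ p∣q → p∤ (∣m⇒∣m*n (product qs) p∣q)))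
        (go qs qs-prime (λ 2∣ → 2∤ (∣n⇒∣m*n q 2∣)) (λ p∣ → p∤ (∣n⇒∣m*n q p∣))))

  σ-closed : ∀ {u x} → ¬ p ∣ u → x ∈ D → σ u x ∈ D
  σ-closed {u} p∤u = multiplier (s u) {{N.≢-nonZero λ s≡0 → p∤s (subst (p ∣_) (sym s≡0) (p ∣0))}} 2∤s p∤s
    where
    T = u ^ (p * p)
    2∤s : ¬ 2 ∣ s u
    2∤s 2∣s = prime∤1 prime[2] (∣m+n∣m⇒∣n (subst (2 ∣_) (trans (cong (λ z → z + 8 * c * T) p⁴≡1+8d) (regroup d c T)) 2∣s)
      (∣-trans (divides 4 refl) (m∣m*n (d + c * T))))
      where
      regroup : ∀ d c T → 1 + 8 * d + 8 * c * T ≡ 8 * (d + c * T) + 1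
      regroup = solve-∀
    p∤s : ¬ p ∣ s u
    p∤s p∣s = [ [ p∤8 , p∤c ]′ ∘ euclidsLemma 8 c p-prime , prime∤^ p-prime p∤u (p * p) ]′
      (euclidsLemma (8 * c) T p-prime (∣m+n∣m⇒∣n p∣s (m∣m*n (p ^ 3))))

  D∩N? : Decidable (λ x → x ∈ D × (8 • x) ≡ ε)
  D∩N? x = (x ∈? D) ×-dec 8•? x

  ∣D∩N∣ : ℕ
  ∣D∩N∣ = ∑ (λ x → 𝟙 (D∩N? x))

  -- The identity lies in N but not in D, which leaves at most seven places.
  ∣D∩N∣≤7 : ∣D∩N∣ ≤ 7
  ∣D∩N∣≤7 = N.s≤s⁻¹ (ℕ.≤-trans (ℕ.≤-reflexive (sym (trans (∑-+ (λ x → 𝟙 (ε ≟ x)) (λ x → 𝟙 (D∩N? x)))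
    (cong (λ z → z + ∣D∩N∣) (∑-𝟙-≟ ε))))) (ℕ.≤-trans (∑-mono _ ν bound) ∣N∣≤8))
    where
    bound : ∀ x → 𝟙 (ε ≟ x) + 𝟙 (D∩N? x) ≤ ν x
    bound x with ε ≟ x | D∩N? x
    ... | yes refl | yes (ε∈D , _) = contradiction ε∈D ε∉D
    ... | yes refl | no _          = ℕ.≤-reflexive (sym (𝟙-yes (8•? ε) (•-ε 8)))
    ... | no _     | yes (_ , 8x)  = ℕ.≤-reflexive (sym (𝟙-yes (8•? x) 8x))
    ... | no _     | no _          = z≤n

  k≡∣D∩N∣-mod : ∃[ b ] k ≡ ∣D∩N∣ + b * (p ∸ 1)
  k≡∣D∩N∣-mod with p-1∣count (_∈? D) σ-closed
  ... | divides b eq = b , trans (sym (trans (∑-𝟙-∈ D) (proj₁ pds)))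
    (trans (∑-𝟙-split (_∈? D) 8•?) (cong (λ z → ∣D∩N∣ + z) eq))

  lam-mod : ∣D∩N∣ ≢ 0 → ∃₂ λ a b → a ≤ ∣D∩N∣ × lam ≡ a + b * (p ∸ 1)
  lam-mod ≢0 with ∑-𝟙≢0 D∩N? ≢0
  ... | x , x∈D , 8x with p-1∣count (Pair? x) closed
    where
    -- As x lies in N it is fixed, so σ u maps x g⁻¹ to x (σ u g)⁻¹.
    closed : ∀ {u g} → ¬ p ∣ u → (x ∙ (g ⁻¹)) ∈ D × g ∈ D → (x ∙ ((σ u g) ⁻¹)) ∈ D × σ u g ∈ D
    closed {u} {g} p∤u (xg⁻¹∈D , g∈D) = subst (_∈ D) (trans (•-distrib-∙ x (g ⁻¹) (s u))
      (cong₂ _∙_ (σ-fixes-N u 8x) (•-⁻¹ (s u) g))) (σ-closed p∤u xg⁻¹∈D) , σ-closed p∤u g∈D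
  ... | divides b eq = ∑ (λ g → 𝟙 (Pair? x g ×-dec 8•? g)) , b , ∑-mono _ _ bound ,
    trans (sym (trans (sym (autocorrelation-count x)) (trans (autocorrelation-rep x x≢ε) (proj₁ (proj₂ pds x x≢ε) x∈D))))
      (trans (∑-𝟙-split (Pair? x) 8•?) (cong (λ z → ∑ (λ g → 𝟙 (Pair? x g ×-dec 8•? g)) + z) eq))
    where
    x≢ε : x ≢ ε
    x≢ε refl = ε∉D x∈D
    bound : ∀ g → 𝟙 (Pair? x g ×-dec 8•? g) ≤ 𝟙 (D∩N? g)
    bound g with Pair? x g ×-dec 8•? g
    ... | yes ((_ , g∈D) , 8g) = ℕ.≤-reflexive (sym (𝟙-yes (D∩N? g) (g∈D , 8g)))
    ... | no _                 = z≤n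

-- Arithmetic of the parameters

nonnegative : ∀ {i n} → + 8 Z.* i ≡ + n → ∃[ t ] i ≡ + t
nonnegative {+ t} _ = t , refl

square-nonnegative : ∀ i → ∃[ n ] i Z.* i ≡ + n
square-nonnegative (+ n)      = n * n , sym (ℤ.pos-* n n)
square-nonnegative Z.-[1+ n ] = suc n * suc n , refl

-- Here t = 4p² − k, so that 2t = 4p − β; the hypothesis on β says that the discriminant of the
-- difference set is (4p)².
quadratic-relation : ∀ {p k lam μ} {β : ℤ} → 1 ≤ p → (β Z.+ + 1) Z.* (β Z.+ + 1) Z.+ + 7 ≡ + 16 Z.* + p →
  μ ≡ 2 * p ∸ 2 → + lam ≡ + μ Z.+ β → + 2 Z.* + k ≡ (+ 8 Z.* + (p ^ 2)) Z.- (+ 4 Z.* + p) Z.+ β →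
  ∃[ t ] lam + 2 * t ≡ 4 * p + μ × k + t * t ≡ 4 * p * t + μ
quadratic-relation {p} {k} {lam} {μ} {β} 1≤p disc μ≡ lam≡ k≡ = t , ℤ.+-injective lam-relation , ℤ.+-injective k-relation
  where
  open ≡-Reasoning
  P K T M L : ℤ
  P = + p
  K = + k
  M = + μ
  L = + lam
  T = + 4 Z.* (P Z.* P) Z.- K

  2K≡ : + 2 Z.* K ≡ + 8 Z.* (P Z.* P) Z.- + 4 Z.* P Z.+ β
  2K≡ = trans k≡ (cong (λ z → + 8 Z.* z Z.- + 4 Z.* P Z.+ β)
    (trans (cong (λ z → + (p * z)) (ℕ.*-identityʳ p)) (ℤ.pos-* p p)))

  M≡ : M ≡ + 2 Z.* P Z.- + 2
  M≡ = begin
    + μ               ≡⟨ cong +_ μ≡ ⟩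
    + (2 * p ∸ 2)     ≡⟨ ℤ.⊖-≥ (ℕ.*-monoʳ-≤ 2 1≤p) ⟨
    (2 * p) Z.⊖ 2     ≡⟨ ℤ.m-n≡m⊖n (2 * p) 2 ⟨
    + (2 * p) Z.- + 2 ≡⟨ cong (Z._- + 2) (ℤ.pos-* 2 p) ⟩
    + 2 Z.* P Z.- + 2 ∎

  2T≡ : + 2 Z.* T ≡ + 4 Z.* P Z.- β
  2T≡ = begin
    + 2 Z.* T                                         ≡⟨ expand P K ⟩
    + 8 Z.* (P Z.* P) Z.- + 2 Z.* K                   ≡⟨ cong (λ z → + 8 Z.* (P Z.* P) Z.- z) 2K≡ ⟩
    + 8 Z.* (P Z.* P) Z.- (+ 8 Z.* (P Z.* P) Z.- + 4 Z.* P Z.+ β) ≡⟨ collect P β ⟩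
    + 4 Z.* P Z.- β                                   ∎
    where
    expand : ∀ P K → + 2 Z.* (+ 4 Z.* (P Z.* P) Z.- K) ≡ + 8 Z.* (P Z.* P) Z.- + 2 Z.* K
    expand = ℤSolver.solve-∀
    collect : ∀ P β → + 8 Z.* (P Z.* P) Z.- (+ 8 Z.* (P Z.* P) Z.- + 4 Z.* P Z.+ β) ≡ + 4 Z.* P Z.- β
    collect = ℤSolver.solve-∀

  -- Completing the square shows that T is nonnegative and hence a legitimate natural coefficient of
  -- E.
  8T≡ : + 8 Z.* T ≡ (β Z.- + 1) Z.* (β Z.- + 1) Z.+ + 7
  8T≡ = begin
    + 8 Z.* T                     ≡⟨ ℤ.*-assoc (+ 4) (+ 2) T ⟩
    + 4 Z.* (+ 2 Z.* T)           ≡⟨ cong (+ 4 Z.*_) 2T≡ ⟩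
    + 4 Z.* (+ 4 Z.* P Z.- β)     ≡⟨ expand P β ⟩
    + 16 Z.* P Z.- + 4 Z.* β      ≡⟨ cong (Z._- + 4 Z.* β) disc ⟨
    (β Z.+ + 1) Z.* (β Z.+ + 1) Z.+ + 7 Z.- + 4 Z.* β ≡⟨ collect β ⟩
    (β Z.- + 1) Z.* (β Z.- + 1) Z.+ + 7 ∎
    where
    expand : ∀ P β → + 4 Z.* (+ 4 Z.* P Z.- β) ≡ + 16 Z.* P Z.- + 4 Z.* β
    expand = ℤSolver.solve-∀
    collect : ∀ β → (β Z.+ + 1) Z.* (β Z.+ + 1) Z.+ + 7 Z.- + 4 Z.* β ≡ (β Z.- + 1) Z.* (β Z.- + 1) Z.+ + 7
    collect = ℤSolver.solve-∀

  t-exists : ∃[ t ] T ≡ + t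
  t-exists with square-nonnegative (β Z.- + 1)
  ... | n , eq = nonnegative {T} {n + 7} (trans 8T≡ (cong (Z._+ + 7) eq))

  t = proj₁ t-exists

  lam-relation : + (lam + 2 * t) ≡ + (4 * p + μ)
  lam-relation = begin
    L Z.+ + (2 * t)                     ≡⟨ cong₂ Z._+_ lam≡ (trans (ℤ.pos-* 2 t) (cong (+ 2 Z.*_) (sym (proj₂ t-exists)))) ⟩
    M Z.+ β Z.+ + 2 Z.* T               ≡⟨ cong (λ z → M Z.+ β Z.+ z) 2T≡ ⟩
    M Z.+ β Z.+ (+ 4 Z.* P Z.- β)       ≡⟨ collect M β P ⟩
    + 4 Z.* P Z.+ M                     ≡⟨ cong (Z._+ M) (ℤ.pos-* 4 p) ⟨
    + (4 * p) Z.+ M                     ∎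
    where
    collect : ∀ M β P → M Z.+ β Z.+ (+ 4 Z.* P Z.- β) ≡ + 4 Z.* P Z.+ M
    collect = ℤSolver.solve-∀

  -- The factor 8 makes K and T appear only through 2K and 2T, which are known without halves.
  k-relation-ℤ : K Z.+ T Z.* T ≡ + 4 Z.* P Z.* T Z.+ M
  k-relation-ℤ = ℤ.*-cancelˡ-≡ (+ 8) _ _ (begin
    + 8 Z.* (K Z.+ T Z.* T)
      ≡⟨ expandˡ K T ⟩
    + 4 Z.* (+ 2 Z.* K) Z.+ + 2 Z.* ((+ 2 Z.* T) Z.* (+ 2 Z.* T))
      ≡⟨ cong₂ (λ a b → + 4 Z.* a Z.+ + 2 Z.* (b Z.* b)) 2K≡ 2T≡ ⟩
    + 4 Z.* (+ 8 Z.* (P Z.* P) Z.- + 4 Z.* P Z.+ β) Z.+ + 2 Z.* ((+ 4 Z.* P Z.- β) Z.* (+ 4 Z.* P Z.- β))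
      ≡⟨ collect P β ⟩
    + 16 Z.* P Z.* (+ 4 Z.* P Z.- β) Z.+ + 2 Z.* ((β Z.+ + 1) Z.* (β Z.+ + 1) Z.+ + 7) Z.- + 16 Z.* P Z.- + 16
      ≡⟨ cong (λ z → + 16 Z.* P Z.* (+ 4 Z.* P Z.- β) Z.+ + 2 Z.* z Z.- + 16 Z.* P Z.- + 16) disc ⟩
    + 16 Z.* P Z.* (+ 4 Z.* P Z.- β) Z.+ + 2 Z.* (+ 16 Z.* P) Z.- + 16 Z.* P Z.- + 16
      ≡⟨ simplify P (+ 4 Z.* P Z.- β) ⟩
    + 16 Z.* P Z.* (+ 4 Z.* P Z.- β) Z.+ + 8 Z.* (+ 2 Z.* P Z.- + 2)
      ≡⟨ cong₂ (λ a b → + 16 Z.* P Z.* a Z.+ + 8 Z.* b) (sym 2T≡) (sym M≡) ⟩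
    + 16 Z.* P Z.* (+ 2 Z.* T) Z.+ + 8 Z.* M
      ≡⟨ expandʳ P T M ⟨
    + 8 Z.* (+ 4 Z.* P Z.* T Z.+ M) ∎)
    where
    expandˡ : ∀ K T → + 8 Z.* (K Z.+ T Z.* T) ≡ + 4 Z.* (+ 2 Z.* K) Z.+ + 2 Z.* ((+ 2 Z.* T) Z.* (+ 2 Z.* T))
    expandˡ = ℤSolver.solve-∀
    collect : ∀ P β → + 4 Z.* (+ 8 Z.* (P Z.* P) Z.- + 4 Z.* P Z.+ β) Z.+ + 2 Z.* ((+ 4 Z.* P Z.- β) Z.* (+ 4 Z.* P Z.- β)) ≡
      + 16 Z.* P Z.* (+ 4 Z.* P Z.- β) Z.+ + 2 Z.* ((β Z.+ + 1) Z.* (β Z.+ + 1) Z.+ + 7) Z.- + 16 Z.* P Z.- + 16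
    collect = ℤSolver.solve-∀
    simplify : ∀ P S → + 16 Z.* P Z.* S Z.+ + 2 Z.* (+ 16 Z.* P) Z.- + 16 Z.* P Z.- + 16 ≡
      + 16 Z.* P Z.* S Z.+ + 8 Z.* (+ 2 Z.* P Z.- + 2)
    simplify = ℤSolver.solve-∀
    expandʳ : ∀ P T M → + 8 Z.* (+ 4 Z.* P Z.* T Z.+ M) ≡ + 16 Z.* P Z.* (+ 2 Z.* T) Z.+ + 8 Z.* M
    expandʳ = ℤSolver.solve-∀

  k-relation : + (k + t * t) ≡ + (4 * p * t + μ)
  k-relation = begin
    K Z.+ + (t * t)              ≡⟨ cong (λ z → K Z.+ z) (ℤ.pos-* t t) ⟩
    K Z.+ + t Z.* + t            ≡⟨ cong (λ z → K Z.+ z Z.* z) (proj₂ t-exists) ⟨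
    K Z.+ T Z.* T                ≡⟨ k-relation-ℤ ⟩
    + 4 Z.* P Z.* T Z.+ M        ≡⟨ cong (λ z → + 4 Z.* P Z.* z Z.+ M) (proj₂ t-exists) ⟩
    + 4 Z.* P Z.* + t Z.+ M      ≡⟨ cong (λ z → z Z.* + t Z.+ M) (ℤ.pos-* 4 p) ⟨
    + (4 * p) Z.* + t Z.+ M      ≡⟨ cong (Z._+ M) (ℤ.pos-* (4 * p) t) ⟨
    + (4 * p * t) Z.+ M          ∎

poly : ℤ → ℤ
poly y = (+ 4 Z.* y Z.* y) Z.+ (+ 5 Z.* y) Z.+ + 2

-- The two values of β are the two signs in β + 1 = ±(8y + 5), and (8y + 5)² + 7 = 16(4y² + 5y + 2).
discriminant : ∀ y {p} {β : ℤ} → + p ≡ poly y → (β ≡ (- (+ 8 Z.* y)) Z.- + 6 ⊎ β ≡ (+ 8 Z.* y) Z.+ + 4) →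
  (β Z.+ + 1) Z.* (β Z.+ + 1) Z.+ + 7 ≡ + 16 Z.* + p
discriminant y p≡ (inj₁ refl) = trans (square y) (cong (+ 16 Z.*_) (sym p≡))
  where
  square : ∀ y → ((- (+ 8 Z.* y)) Z.- + 6 Z.+ + 1) Z.* ((- (+ 8 Z.* y)) Z.- + 6 Z.+ + 1) Z.+ + 7 ≡
    + 16 Z.* ((+ 4 Z.* y Z.* y) Z.+ (+ 5 Z.* y) Z.+ + 2)
  square = ℤSolver.solve-∀
discriminant y p≡ (inj₂ refl) = trans (square y) (cong (+ 16 Z.*_) (sym p≡))
  where
  square : ∀ y → ((+ 8 Z.* y) Z.+ + 4 Z.+ + 1) Z.* ((+ 8 Z.* y) Z.+ + 4 Z.+ + 1) Z.+ + 7 ≡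
    + 16 Z.* ((+ 4 Z.* y Z.* y) Z.+ (+ 5 Z.* y) Z.+ + 2)
  square = ℤSolver.solve-∀

-- Modulo p − 1 = (4y + 1)(y + 1) one has 2k ≡ 4 + β.
residue : ∀ {y K J B β : ℤ} → K ≡ J Z.+ B Z.* (poly y Z.- + 1) →
  + 2 Z.* K ≡ + 8 Z.* (poly y Z.* poly y) Z.- + 4 Z.* poly y Z.+ β →
  ∃[ m ] + 2 Z.* J ≡ + 4 Z.+ β Z.+ + 2 Z.* ((+ 4 Z.* y Z.+ + 1) Z.* ((y Z.+ + 1) Z.* m))
-- With P = `poly y`, the witness comes from 8P² - 4P - 4 = 2(P - 1)(4P + 2).
residue {y} {K} {J} {B} {β} K≡ 2K≡ = + 4 Z.* poly y Z.+ + 2 Z.- B , (begin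
  + 2 Z.* J
    ≡⟨ isolate J B (poly y) ⟩
  + 2 Z.* (J Z.+ B Z.* (poly y Z.- + 1)) Z.- + 2 Z.* B Z.* (poly y Z.- + 1)
    ≡⟨ cong (λ z → z Z.- + 2 Z.* B Z.* (poly y Z.- + 1)) (trans (cong (+ 2 Z.*_) (sym K≡)) 2K≡) ⟩
  + 8 Z.* (poly y Z.* poly y) Z.- + 4 Z.* poly y Z.+ β Z.- + 2 Z.* B Z.* (poly y Z.- + 1)
    ≡⟨ divide (poly y) β B ⟩
  + 4 Z.+ β Z.+ + 2 Z.* ((poly y Z.- + 1) Z.* (+ 4 Z.* poly y Z.+ + 2 Z.- B))
    ≡⟨ cong (λ z → + 4 Z.+ β Z.+ + 2 Z.* z) (trans (cong (Z._* (+ 4 Z.* poly y Z.+ + 2 Z.- B)) (factor y))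
         (ℤ.*-assoc (+ 4 Z.* y Z.+ + 1) (y Z.+ + 1) _)) ⟩
  + 4 Z.+ β Z.+ + 2 Z.* ((+ 4 Z.* y Z.+ + 1) Z.* ((y Z.+ + 1) Z.* (+ 4 Z.* poly y Z.+ + 2 Z.- B))) ∎)
  where
  open ≡-Reasoning
  isolate : ∀ J B P → + 2 Z.* J ≡ + 2 Z.* (J Z.+ B Z.* (P Z.- + 1)) Z.- + 2 Z.* B Z.* (P Z.- + 1)
  isolate = ℤSolver.solve-∀
  divide : ∀ P β B → + 8 Z.* (P Z.* P) Z.- + 4 Z.* P Z.+ β Z.- + 2 Z.* B Z.* (P Z.- + 1) ≡
    + 4 Z.+ β Z.+ + 2 Z.* ((P Z.- + 1) Z.* (+ 4 Z.* P Z.+ + 2 Z.- B))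
  divide = ℤSolver.solve-∀
  factor : ∀ y → (+ 4 Z.* y Z.* y) Z.+ (+ 5 Z.* y) Z.+ + 2 Z.- + 1 ≡ (+ 4 Z.* y Z.+ + 1) Z.* (y Z.+ + 1)
  factor = ℤSolver.solve-∀

abs-∣ : ∀ i j {k : ℤ} → k ≡ i Z.* j → Z.∣ i ∣ ∣ Z.∣ k ∣
abs-∣ i j k≡ = divides Z.∣ j ∣ (trans (cong Z.∣_∣ k≡) (trans (ℤ.abs-* i j) (ℕ.*-comm Z.∣ i ∣ Z.∣ j ∣)))

-- Halving gives J ≡ -(4y + 1) modulo p - 1, and -(4y + 1) = 3 - 4(y + 1).
residue₁ : ∀ {y J m : ℤ} → + 2 Z.* J ≡ + 4 Z.+ ((- (+ 8 Z.* y)) Z.- + 6) Z.+ + 2 Z.* ((+ 4 Z.* y Z.+ + 1) Z.* ((y Z.+ + 1) Z.* m)) →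
  (Z.∣ + 4 Z.* y Z.+ + 1 ∣ ∣ Z.∣ J ∣) × (Z.∣ y Z.+ + 1 ∣ ∣ Z.∣ J Z.- + 3 ∣)
residue₁ {y} {J} {m} 2J≡ =
  abs-∣ (+ 4 Z.* y Z.+ + 1) ((y Z.+ + 1) Z.* m Z.- + 1) J≡ ,
  abs-∣ (y Z.+ + 1) ((+ 4 Z.* y Z.+ + 1) Z.* m Z.- + 4) (trans (cong (Z._- + 3) J≡) (subtract y m))
  where
  halve : ∀ y m → + 4 Z.+ ((- (+ 8 Z.* y)) Z.- + 6) Z.+ + 2 Z.* ((+ 4 Z.* y Z.+ + 1) Z.* ((y Z.+ + 1) Z.* m)) ≡
    + 2 Z.* ((+ 4 Z.* y Z.+ + 1) Z.* ((y Z.+ + 1) Z.* m Z.- + 1))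
  halve = ℤSolver.solve-∀
  J≡ : J ≡ (+ 4 Z.* y Z.+ + 1) Z.* ((y Z.+ + 1) Z.* m Z.- + 1)
  J≡ = ℤ.*-cancelˡ-≡ (+ 2) _ _ (trans 2J≡ (halve y m))
  subtract : ∀ y m → (+ 4 Z.* y Z.+ + 1) Z.* ((y Z.+ + 1) Z.* m Z.- + 1) Z.- + 3 ≡
    (y Z.+ + 1) Z.* ((+ 4 Z.* y Z.+ + 1) Z.* m Z.- + 4)
  subtract = ℤSolver.solve-∀

-- Halving gives J ≡ 4(y + 1) modulo p - 1, and 4(y + 1) = (4y + 1) + 3; the two factors exchange
-- their roles.
residue₂ : ∀ {y J m : ℤ} → + 2 Z.* J ≡ + 4 Z.+ ((+ 8 Z.* y) Z.+ + 4) Z.+ + 2 Z.* ((+ 4 Z.* y Z.+ + 1) Z.* ((y Z.+ + 1) Z.* m)) →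
  (Z.∣ y Z.+ + 1 ∣ ∣ Z.∣ J ∣) × (Z.∣ + 4 Z.* y Z.+ + 1 ∣ ∣ Z.∣ J Z.- + 3 ∣)
residue₂ {y} {J} {m} 2J≡ =
  abs-∣ (y Z.+ + 1) ((+ 4 Z.* y Z.+ + 1) Z.* m Z.+ + 4) J≡ ,
  abs-∣ (+ 4 Z.* y Z.+ + 1) ((y Z.+ + 1) Z.* m Z.+ + 1) (trans (cong (Z._- + 3) J≡) (subtract y m))
  where
  halve : ∀ y m → + 4 Z.+ ((+ 8 Z.* y) Z.+ + 4) Z.+ + 2 Z.* ((+ 4 Z.* y Z.+ + 1) Z.* ((y Z.+ + 1) Z.* m)) ≡
    + 2 Z.* ((y Z.+ + 1) Z.* ((+ 4 Z.* y Z.+ + 1) Z.* m Z.+ + 4))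
  halve = ℤSolver.solve-∀
  J≡ : J ≡ (y Z.+ + 1) Z.* ((+ 4 Z.* y Z.+ + 1) Z.* m Z.+ + 4)
  J≡ = ℤ.*-cancelˡ-≡ (+ 2) _ _ (trans 2J≡ (halve y m))
  subtract : ∀ y m → (y Z.+ + 1) Z.* ((+ 4 Z.* y Z.+ + 1) Z.* m Z.+ + 4) Z.- + 3 ≡
    (+ 4 Z.* y Z.+ + 1) Z.* ((y Z.+ + 1) Z.* m Z.+ + 1)
  subtract = ℤSolver.solve-∀

-- One of the two bounds fails only for y from -2 to 2 and for y = -4. There p is 8, 1, 2, 11, 28
-- and 46, so that y = 1 alone survives.
admissible : ∀ y {p} → + p ≡ poly y → Prime p → 5 ≤ p →
  (y ≡ + 1) ⊎ ((¬ Z.∣ y Z.+ + 1 ∣ ∣ 3) × 8 ≤ Z.∣ + 4 Z.* y Z.+ + 1 ∣)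
admissible (+ 0) refl _ (s≤s (s≤s ()))
admissible (+ 1) _ _ _ = inj₁ refl
admissible (+ 2) refl p-prime _ = contradiction p-prime (from-no (prime? 28))
admissible (+ suc (suc (suc n))) _ _ _ = inj₂ (>⇒∤ (subst (4 ≤_) (ℕ.+-comm 1 (3 + n)) (ℕ.m≤m+n 4 n)) ,
  subst (8 ≤_) (expand n) (ℕ.m≤m+n 8 (4 * n + 5)))
  where
  expand : ∀ n → 8 + (4 * n + 5) ≡ 4 * (3 + n) + 1
  expand = solve-∀
admissible Z.-[1+ 0 ] refl _ (s≤s ())
admissible Z.-[1+ 1 ] refl p-prime _ = contradiction p-prime (from-no (prime? 8))
admissible Z.-[1+ 2 ] _ _ _ = inj₂ (from-no (2 ∣? 3) , ℕ.m≤m+n 8 3)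
admissible Z.-[1+ 3 ] refl p-prime _ = contradiction p-prime (from-no (prime? 46))
admissible Z.-[1+ suc (suc (suc (suc n))) ] _ _ _ = inj₂ (>⇒∤ (ℕ.m≤m+n 4 n) ,
  ℕ.+-mono-≤ (ℕ.m≤m+n 4 n) (ℕ.≤-trans (ℕ.m≤m+n 4 (suc n)) (ℕ.m≤m+n (4 + suc n) _)))

odd-prime : ∀ {p} → Prime p → 5 ≤ p → ∃[ h ] p ≡ 1 + 2 * h
odd-prime {p} p-prime 5≤p with p % 2 in p%2≡ | m%n<n p 2
... | 0 | _ = contradiction (prime⇒irreducible p-prime (m%n≡0⇒n∣m p 2 p%2≡))
  λ { (inj₂ refl) → contradiction 5≤p λ { (s≤s (s≤s ())) } }
... | 1 | _ = p / 2 , trans (m≡m%n+[m/n]*n p 2) (cong₂ _+_ p%2≡ (ℕ.*-comm (p / 2) 2))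
... | suc (suc _) | s≤s (s≤s ())

-- A multiple of b ≥ 8 that is at most 7 is 0, and then a divides 3.
impossible-residue₁ : ∀ {a b} j → j ≤ 7 → ¬ a ∣ 3 → 8 ≤ b → b ∣ j → a ∣ Z.∣ + j Z.- + 3 ∣ → ⊥
impossible-residue₁ zero      _   a∤3 8≤b b∣j a∣3 = a∤3 a∣3
impossible-residue₁ j@(suc _) j≤7 a∤3 8≤b b∣j _   = >⇒∤ (ℕ.≤-trans (s≤s j≤7) 8≤b) b∣j

-- Since |j - 3| ≤ 4 < b, divisibility by b forces j = 3, and then a divides 3.
impossible-residue₂ : ∀ {a b} j → j ≤ 7 → ¬ a ∣ 3 → 5 ≤ b → a ∣ j → b ∣ Z.∣ + j Z.- + 3 ∣ → ⊥
impossible-residue₂ 0 _ a∤3 5≤b a∣j b∣ = >⇒∤ (ℕ.≤-trans (ℕ.m≤m+n 4 1) 5≤b) b∣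
impossible-residue₂ 1 _ a∤3 5≤b a∣j b∣ = >⇒∤ (ℕ.≤-trans (ℕ.m≤m+n 3 2) 5≤b) b∣
impossible-residue₂ 2 _ a∤3 5≤b a∣j b∣ = >⇒∤ (ℕ.≤-trans (ℕ.m≤m+n 2 3) 5≤b) b∣
impossible-residue₂ 3 _ a∤3 5≤b a∣j b∣ = a∤3 a∣j
impossible-residue₂ 4 _ a∤3 5≤b a∣j b∣ = >⇒∤ (ℕ.≤-trans (ℕ.m≤m+n 2 3) 5≤b) b∣
impossible-residue₂ 5 _ a∤3 5≤b a∣j b∣ = >⇒∤ (ℕ.≤-trans (ℕ.m≤m+n 3 2) 5≤b) b∣
impossible-residue₂ 6 _ a∤3 5≤b a∣j b∣ = >⇒∤ (ℕ.≤-trans (ℕ.m≤m+n 4 1) 5≤b) b∣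
impossible-residue₂ 7 _ a∤3 5≤b a∣j b∣ = >⇒∤ 5≤b b∣
impossible-residue₂ (suc (suc (suc (suc (suc (suc (suc (suc j)))))))) (s≤s (s≤s (s≤s (s≤s (s≤s (s≤s (s≤s ()))))))) _ _ _ _

exceptional-residue : ∀ j → j ≤ 7 → 5 ∣ j → 2 ∣ Z.∣ + j Z.- + 3 ∣ → j ≡ 5
exceptional-residue 0 _ _ 2∣3 = contradiction 2∣3 (from-no (2 ∣? 3))
exceptional-residue 1 _ 5∣j _ = contradiction 5∣j (from-no (5 ∣? 1))
exceptional-residue 2 _ 5∣j _ = contradiction 5∣j (from-no (5 ∣? 2))
exceptional-residue 3 _ 5∣j _ = contradiction 5∣j (from-no (5 ∣? 3))
exceptional-residue 4 _ 5∣j _ = contradiction 5∣j (from-no (5 ∣? 4))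
exceptional-residue 5 _ _ _ = refl
exceptional-residue 6 _ 5∣j _ = contradiction 5∣j (from-no (5 ∣? 6))
exceptional-residue 7 _ 5∣j _ = contradiction 5∣j (from-no (5 ∣? 7))
exceptional-residue (suc (suc (suc (suc (suc (suc (suc (suc j)))))))) (s≤s (s≤s (s≤s (s≤s (s≤s (s≤s (s≤s ()))))))) _ _

6≢a+10b : ∀ {a} b → a ≤ 5 → 6 ≢ a + b * 10
6≢a+10b {a} zero    a≤5 eq = ℕ.<⇒≢ (s≤s a≤5) (sym (trans eq (ℕ.+-identityʳ a)))
6≢a+10b {a} (suc b) a≤5 eq = ℕ.<⇒≢ (ℕ.≤-trans (ℕ.m≤m+n 7 3) (ℕ.≤-trans (ℕ.m≤m+n 10 (b * 10)) (ℕ.m≤n+m _ a))) eq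

contradictory-parameters : ∀ y {p} {β : ℤ} {μ lam k j b} → + p ≡ poly y → Prime p → 5 ≤ p →
  (β ≡ (- (+ 8 Z.* y)) Z.- + 6 ⊎ β ≡ (+ 8 Z.* y) Z.+ + 4) →
  μ ≡ 2 * p ∸ 2 → + lam ≡ + μ Z.+ β → + 2 Z.* + k ≡ (+ 8 Z.* + (p ^ 2)) Z.- (+ 4 Z.* + p) Z.+ β →
  j ≤ 7 → k ≡ j + b * (p ∸ 1) → (j ≢ 0 → ∃₂ λ a c → a ≤ j × lam ≡ a + c * (p ∸ 1)) → ⊥
contradictory-parameters y {p} {β} {μ} {lam} {k} {j} {b} p≡ p-prime 5≤p β≡ μ≡ lam≡ 2k≡ j≤7 k≡ lam-mod =
  cases β≡ (admissible y p≡ p-prime 5≤p)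
  where
  p-1≡ : + (p ∸ 1) ≡ poly y Z.- + 1
  p-1≡ = trans (sym (trans (ℤ.m-n≡m⊖n p 1) (ℤ.⊖-≥ (ℕ.≤-trans (ℕ.m≤m+n 1 4) 5≤p)))) (cong (Z._- + 1) p≡)

  2J≡ : ∃[ m ] + 2 Z.* + j ≡ + 4 Z.+ β Z.+ + 2 Z.* ((+ 4 Z.* y Z.+ + 1) Z.* ((y Z.+ + 1) Z.* m))
  2J≡ = residue {y} {+ k} {+ j} {+ b} {β}
    (trans (cong +_ k≡) (cong (λ z → + j Z.+ z) (trans (ℤ.pos-* b (p ∸ 1)) (cong (+ b Z.*_) p-1≡))))
    (trans 2k≡ (cong₂ (λ P² P → + 8 Z.* P² Z.- + 4 Z.* P Z.+ β)
      (trans (cong (λ z → + (p * z)) (ℕ.*-identityʳ p)) (trans (ℤ.pos-* p p) (cong₂ Z._*_ p≡ p≡))) p≡))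

  exceptional : y ≡ + 1 → β ≡ - + 14 → j ≡ 5 → ⊥
  exceptional y≡1 β≡-14 j≡5 = conclude (lam-mod (λ j≡0 → contradiction (trans (sym j≡5) j≡0) λ ()))
    where
    open ≡-Reasoning
    p≡11 : p ≡ 11
    p≡11 = ℤ.+-injective (trans p≡ (cong poly y≡1))
    lam≡6 : lam ≡ 6
    lam≡6 = ℤ.+-injective (trans lam≡ (cong₂ (λ a b → + a Z.+ b) (trans μ≡ (cong (λ z → 2 * z ∸ 2) p≡11)) β≡-14))
    conclude : (∃₂ λ a c → a ≤ j × lam ≡ a + c * (p ∸ 1)) → ⊥
    conclude (a , c , a≤j , lam≡a+c[p-1]) = 6≢a+10b c (subst (a ≤_) j≡5 a≤j) (begin
      6                 ≡⟨ lam≡6 ⟨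
      lam               ≡⟨ lam≡a+c[p-1] ⟩
      a + c * (p ∸ 1)   ≡⟨ cong (λ z → a + c * (z ∸ 1)) p≡11 ⟩
      a + c * 10        ∎)

  case₁ : β ≡ (- (+ 8 Z.* y)) Z.- + 6 → (Z.∣ + 4 Z.* y Z.+ + 1 ∣ ∣ j) × (Z.∣ y Z.+ + 1 ∣ ∣ Z.∣ + j Z.- + 3 ∣) →
    (y ≡ + 1) ⊎ ((¬ Z.∣ y Z.+ + 1 ∣ ∣ 3) × 8 ≤ Z.∣ + 4 Z.* y Z.+ + 1 ∣) → ⊥
  case₁ _ (∣j , ∣j-3) (inj₂ (a∤3 , 8≤b)) = impossible-residue₁ j j≤7 a∤3 8≤b ∣j ∣j-3
  case₁ β≡ (∣j , ∣j-3) (inj₁ y≡1) = exceptional y≡1 (trans β≡ (cong (λ z → (- (+ 8 Z.* z)) Z.- + 6) y≡1))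
    (exceptional-residue j j≤7 (subst (λ z → Z.∣ + 4 Z.* z Z.+ + 1 ∣ ∣ j) y≡1 ∣j)
      (subst (λ z → Z.∣ z Z.+ + 1 ∣ ∣ Z.∣ + j Z.- + 3 ∣) y≡1 ∣j-3))

  case₂ : (Z.∣ y Z.+ + 1 ∣ ∣ j) × (Z.∣ + 4 Z.* y Z.+ + 1 ∣ ∣ Z.∣ + j Z.- + 3 ∣) →
    (y ≡ + 1) ⊎ ((¬ Z.∣ y Z.+ + 1 ∣ ∣ 3) × 8 ≤ Z.∣ + 4 Z.* y Z.+ + 1 ∣) → ⊥
  case₂ (∣j , ∣j-3) (inj₂ (a∤3 , 8≤b)) =
    impossible-residue₂ j j≤7 a∤3 (ℕ.≤-trans (ℕ.m≤m+n 5 3) 8≤b) ∣j ∣j-3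
  -- For p = 11 the moduli are 2 and 5. With this sign of β they already exclude every j; hence the
  -- bound 5 rather than 8 in `impossible-residue₂`.
  case₂ (∣j , ∣j-3) (inj₁ y≡1) = impossible-residue₂ j j≤7
    (subst (λ z → ¬ Z.∣ z Z.+ + 1 ∣ ∣ 3) (sym y≡1) (from-no (2 ∣? 3)))
    (subst (λ z → 5 ≤ Z.∣ + 4 Z.* z Z.+ + 1 ∣) (sym y≡1) ℕ.≤-refl) ∣j ∣j-3

  replace : ∀ {β′} → β ≡ β′ → + 4 Z.+ β Z.+ + 2 Z.* ((+ 4 Z.* y Z.+ + 1) Z.* ((y Z.+ + 1) Z.* proj₁ 2J≡)) ≡
    + 4 Z.+ β′ Z.+ + 2 Z.* ((+ 4 Z.* y Z.+ + 1) Z.* ((y Z.+ + 1) Z.* proj₁ 2J≡))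
  replace refl = refl

  cases : (β ≡ (- (+ 8 Z.* y)) Z.- + 6 ⊎ β ≡ (+ 8 Z.* y) Z.+ + 4) →
    (y ≡ + 1) ⊎ ((¬ Z.∣ y Z.+ + 1 ∣ ∣ 3) × 8 ≤ Z.∣ + 4 Z.* y Z.+ + 1 ∣) → ⊥
  cases (inj₁ β≡) = case₁ β≡ (residue₁ {y} {+ j} {proj₁ 2J≡} (trans (proj₂ 2J≡) (replace β≡)))
  cases (inj₂ β≡) = case₂ (residue₂ {y} {+ j} {proj₁ 2J≡} (trans (proj₂ 2J≡) (replace β≡)))

no-regular-PDS : ∀ y {p} {β : ℤ} {μ lam k} → + p ≡ poly y → Prime p → 5 ≤ p →
  (β ≡ (- (+ 8 Z.* y)) Z.- + 6 ⊎ β ≡ (+ 8 Z.* y) Z.+ + 4) →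
  μ ≡ 2 * p ∸ 2 → + lam ≡ + μ Z.+ β → + 2 Z.* + k ≡ (+ 8 Z.* + (p ^ 2)) Z.- (+ 4 Z.* + p) Z.+ β →
  ∀ {v} → v ≡ 8 * p ^ 3 → {_∙_ : Op₂ (Fin v)} {ε : Fin v} {_⁻¹ : Op₁ (Fin v)} → IsAbelianGroup _≡_ _∙_ ε _⁻¹ →
  {D : Subset v} → PDSDefs.IsPDS _∙_ ε _⁻¹ D k lam μ → PDSDefs.IsRegular _∙_ ε _⁻¹ D → ⊥
no-regular-PDS y {p} {β} {μ} {lam} {k} p≡ p-prime 5≤p β≡ μ≡ lam≡ k≡ v≡8p³ isAbelianGroup pds regular =
  contradictory-parameters y {p} {β} {μ} {lam} {k} {b = proj₁ PDS.k≡∣D∩N∣-mod} p≡ p-prime 5≤p β≡ μ≡ lam≡ k≡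
    PDS.∣D∩N∣≤7 (proj₂ PDS.k≡∣D∩N∣-mod) PDS.lam-mod
  where
  odd = odd-prime p-prime 5≤p
  relation = quadratic-relation {p} {k} {lam} {μ} {β} (ℕ.≤-trans (ℕ.m≤m+n 1 4) 5≤p) (discriminant y {p} {β} p≡ β≡) μ≡ lam≡ k≡
  module PDS = RegularPDS p-prime (proj₁ odd) (proj₂ odd) v≡8p³ isAbelianGroup pds regular
    (proj₁ relation) (proj₁ (proj₂ relation)) (proj₂ (proj₂ relation))

theorem4 : (y : ℤ) (p : ℕ) → + p ≡ (+ 4 Z.* y Z.* y) Z.+ (+ 5 Z.* y) Z.+ + 2 → Prime p → 5 ≤ p →
    (β : ℤ) → (β ≡ (- (+ 8 Z.* y)) Z.- + 6 ⊎ β ≡ (+ 8 Z.* y) Z.+ + 4) →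
    (μ lam k : ℕ) → μ ≡ 2 N.* p ∸ 2 → + lam ≡ + μ Z.+ β →
    + 2 Z.* + k ≡ (+ 8 Z.* + (p ^ 2)) Z.- (+ 4 Z.* + p) Z.+ β →
    (_∙_ : Op₂ (Fin (8 N.* p ^ 3))) (ε : Fin (8 N.* p ^ 3)) (_⁻¹ : Op₁ (Fin (8 N.* p ^ 3))) →
    IsAbelianGroup _≡_ _∙_ ε _⁻¹ →
    (D : Subset (8 N.* p ^ 3)) →
    ¬ (PDSDefs.IsPDS _∙_ ε _⁻¹ D k lam μ × PDSDefs.IsRegular _∙_ ε _⁻¹ D × ¬ PDSDefs.IsTrivial _∙_ ε _⁻¹ D)
theorem4 y p p≡ p-prime 5≤p β β≡ μ lam k μ≡ lam≡ k≡ _∙_ ε _⁻¹ isAbelianGroup D (pds , regular , _) =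
  no-regular-PDS y p≡ p-prime 5≤p β≡ μ≡ lam≡ k≡ refl isAbelianGroup pds regular
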